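{- Let $T=\{3412,3421,2341\}$ and let $F_T(x)=\sum_{n\ge0}|S_n(T)|x^n$. Then $$F_T(x)=1+\frac{1+rt}{1+1/r+1/t-1/x},$$ where $$r=r(x)=\frac{\left(\sqrt{5}-1\right)\left(1-\sqrt{1-\left(3+\sqrt{5}\right)x+\frac{1}{2}\left(3-\sqrt{5}\right)x^2}\right)-\left(1+\sqrt{5}\right)x}{4x}$$ and $t=t(x)$ is the same expression as $r$ but with $\sqrt{5}$ replaced by $-\sqrt{5}$ throughout (the inner square roots being the power series with constant term $1$).
   Context: $S_n$ is the set of permutations of $[n]$ ($S_0$ contains the empty permutation). A permutation avoids a pattern $\tau$ if it has no subsequence order-isomorphic to $\tau$; $S_n(T)$ is the set of permutations in $S_n$ avoiding every pattern in $T$. -}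

module Defs where

open import Data.Nat as ℕ using (ℕ; zero; suc; _∸_)
open import Data.Integer as ℤ using (ℤ; +_)
open import Data.Rational as ℚ using (ℚ; 0ℚ; 1ℚ; ½)
open import Data.Fin as Fin using (Fin)
open import Data.List using (List; []; _∷_; length; lookup; map; upTo)
open import Data.List.Relation.Binary.Sublist.Propositional using (_⊆_)
open import Data.List.Relation.Binary.Permutation.Propositional using (_↭_)
open import Data.List.Relation.Unary.All using (All)
open import Data.List.Relation.Unary.Unique.Propositional using (Unique)
open import Data.List.Membership.Propositional using (_∈_)
open import Data.Product using (Σ; Σ-syntax; ∃; ∃-syntax; _×_)
open import Function.Bundles using (_⇔_)
open import Relation.Binary.PropositionalEquality using (_≡_)
open import Relation.Nullary using (¬_)

IsPerm : ℕ → List ℕ → Set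
IsPerm n σ = σ ↭ map suc (upTo n)

OrderIso : List ℕ → List ℕ → Set
OrderIso xs ys =
  Σ[ eq ∈ length xs ≡ length ys ]
    (∀ i j → (lookup xs i ℕ.< lookup xs j)
           ⇔ (lookup ys (Fin.cast eq i) ℕ.< lookup ys (Fin.cast eq j)))

Contains : List ℕ → List ℕ → Set
Contains σ τ = ∃[ s ] (s ⊆ σ × OrderIso s τ)

Avoids : List ℕ → List ℕ → Set
Avoids σ τ = ¬ Contains σ τ

AvoidsAll : List ℕ → List (List ℕ) → Set
AvoidsAll σ T = All (Avoids σ) T

InSnT : List (List ℕ) → ℕ → List ℕ → Set
InSnT T n σ = IsPerm n σ × AvoidsAll σ T

HasCard : (List ℕ → Set) → ℕ → Set
HasCard P c = ∃[ L ] (Unique L × length L ≡ c × (∀ σ → (σ ∈ L ⇔ P σ)))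

Tpat : List (List ℕ)
Tpat = (3 ∷ 4 ∷ 1 ∷ 2 ∷ []) ∷ (3 ∷ 4 ∷ 2 ∷ 1 ∷ []) ∷ (2 ∷ 3 ∷ 4 ∷ 1 ∷ []) ∷ []

record K : Set where
  constructor _⊕_√5
  field
    re im : ℚ
open K public

infixl 6 _+ₖ_ _-ₖ_
infixl 7 _*ₖ_

_+ₖ_ : K → K → K
(a ⊕ b √5) +ₖ (c ⊕ d √5) = (a ℚ.+ c) ⊕ (b ℚ.+ d) √5

-ₖ_ : K → K
-ₖ (a ⊕ b √5) = (ℚ.- a) ⊕ (ℚ.- b) √5

_-ₖ_ : K → K → K
x -ₖ y = x +ₖ (-ₖ y)

_*ₖ_ : K → K → K
(a ⊕ b √5) *ₖ (c ⊕ d √5) =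
  (a ℚ.* c ℚ.+ (+ 5 ℚ./ 1) ℚ.* (b ℚ.* d)) ⊕ (a ℚ.* d ℚ.+ b ℚ.* c) √5

ofℚ : ℚ → K
ofℚ q = q ⊕ 0ℚ √5

0ₖ 1ₖ √5ₖ : K
0ₖ = ofℚ 0ℚ
1ₖ = ofℚ 1ℚ
√5ₖ = 0ℚ ⊕ 1ℚ √5

ofℕₖ : ℕ → K
ofℕₖ n = ofℚ (+ n ℚ./ 1)

-- Formal power series over ℚ(√5): coefficient sequences

PS : Set
PS = ℕ → K

infix 4 _≋_
_≋_ : PS → PS → Set
f ≋ g = ∀ n → f n ≡ g n

infixl 6 _+ₚ_ _-ₚ_
infixl 7 _*ₚ_

_+ₚ_ : PS → PS → PS
(f +ₚ g) n = f n +ₖ g n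

_-ₚ_ : PS → PS → PS
(f -ₚ g) n = f n -ₖ g n

sumK : ℕ → (ℕ → K) → K
sumK zero    h = 0ₖ
sumK (suc m) h = sumK m h +ₖ h m

_*ₚ_ : PS → PS → PS
(f *ₚ g) n = sumK (suc n) (λ k → f k *ₖ g (n ∸ k))

const : K → PS
const c zero    = c
const c (suc n) = 0ₖ

X : PS
X (suc zero) = 1ₖ
X _          = 0ₖ

NonZeroPS : PS → Set
NonZeroPS f = ∃[ n ] ¬ (f n ≡ 0ₖ)

ofSeq : (ℕ → ℕ) → PS
ofSeq a n = ofℕₖ (a n)

-- The data of Theorem 3.44, with ε = +1 for r and ε = −1 for t
-- (ε√5 denoted e below).

radicand : K → PS
radicand e = const 1ₖ -ₚ const (ofℕₖ 3 +ₖ e) *ₚ X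
               +ₚ const (ofℚ ½ *ₖ (ofℕₖ 3 -ₖ e)) *ₚ X *ₚ X

IsSqrt : K → PS → Set
IsSqrt e s = (s 0 ≡ 1ₖ) × (s *ₚ s ≋ radicand e)

IsRoot : K → PS → PS → Set
IsRoot e s r =
  const (ofℕₖ 4) *ₚ X *ₚ r
    ≋ const (e -ₖ 1ₖ) *ₚ (const 1ₖ -ₚ s) -ₚ const (1ₖ +ₖ e) *ₚ X

{-# OPTIONS --safe #-}
module Submission where

-- Append the last value of a permutation, standardising the earlier ones.  Call an entry b bad if it starts a
-- pattern b c d with b < c and d < b or d > c: nothing below a bad entry may be appended any more, so if B is the
-- largest bad entry (or 0), exactly the values v > B of a permutation of [n] are allowed.  The tree of avoiders
-- below a permutation only depends on
--   J q:   q = n − B, if every ascent pair b < c has b ≤ B, and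
--   H p q: last entry B + 1 + p = n − q,
-- which have the children
--   J q   ⟶ H i (q − i), 0 ≤ i ≤ q;
--   H p q ⟶ p copies of J (q + 1), H p (q + 1), and H (i + 1) (q − i), 0 ≤ i ≤ q.
-- The generating functions solve the resulting linear recurrences.  These have characteristic roots 1 + φ r and
-- 1 + φ̄ t, where φ = (1 + √5)/2, r = x (1 + r)(1 + φ r) and t is the conjugate of r; so J q is
-- (1 + r)(1 + t)(φ (1 + φ r)^q − φ̄ (1 + φ̄ t)^q) / W with W = φ (1 + t) − φ̄ (1 + r), and the theorem is about J 0.

open import Defs
open import Data.Nat using (ℕ)
open import Data.Product using (_×_)

open import Algebra.Bundles using (CommutativeRing)
import Algebra.Properties.Ring
import Algebra.Solver.Ring
open import Algebra.Solver.Ring.AlmostCommutativeRing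
  using (AlmostCommutativeRing; fromCommutativeRing; _-Raw-AlmostCommutative⟶_)
import Algebra.Solver.Ring.Simple
open import Algebra.Structures using (IsCommutativeRing)
open import Data.Empty using (⊥; ⊥-elim)
open import Data.Fin using (Fin)
open import Data.Fin.Patterns using (0F; 1F; 2F; 3F)
open import Data.Integer as ℤ using (+_)
import Data.Integer.Properties as ℤ
open import Data.List using (List; []; _∷_; _++_; map; reverse; upTo)
open import Data.List.Membership.Propositional using (_∈_)
open import Data.List.Membership.Propositional.Properties
  using (∈-++⁺ˡ; ∈-++⁺ʳ; ∈-++⁻; ∈-map⁺; ∈-map⁻; ∈-upTo⁺; ∈-upTo⁻)
open import Data.List.Membership.Propositional.Properties.WithK using (unique∧set⇒bag)
open import Data.List.Properties
  using (length-++; length-map; map-∘; map-id-local; map-injective; reverse-injective; reverse-involutive;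
         ∷-injectiveˡ; ∷-injectiveʳ)
open import Data.List.Relation.Binary.BagAndSetEquality using (∼bag⇒↭)
open import Data.List.Relation.Binary.Permutation.Propositional using (_↭_; ↭-sym; ↭-trans; ↭⇒↭ₛ)
open import Data.List.Relation.Binary.Permutation.Propositional.Properties using (↭-length; ∈-resp-↭; ↭-reverse)
import Data.List.Relation.Binary.Permutation.Setoid.Properties as Permutationₛ
open import Data.List.Relation.Binary.Sublist.Heterogeneous.Properties using (reverse⁺)
open import Data.List.Relation.Binary.Sublist.Propositional using (_⊆_; []; _∷_; _∷ʳ_; from∈; to∈)
import Data.List.Relation.Binary.Sublist.Propositional.Properties as Sublist
open import Data.List.Relation.Unary.All as All using (All; []; _∷_)
open import Data.List.Relation.Unary.AllPairs using ([]; _∷_)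
open import Data.List.Relation.Unary.Any using (here; there)
open import Data.List.Relation.Unary.Unique.Propositional using (Unique)
import Data.List.Relation.Unary.Unique.Propositional.Properties as Unique
open import Data.Maybe using (Maybe; just; nothing)
open import Data.Nat as ℕ using (zero; suc; _∸_; _≤_; _<_; z≤n; s≤s)
import Data.Nat.Properties as ℕ
open import Data.Product using (∃-syntax; _,_)
open import Data.Rational as ℚ using (0ℚ; 1ℚ; ½; toℚᵘ)
import Data.Rational.Properties as ℚ
import Data.Rational.Solver
open import Data.Rational.Unnormalised as ℚᵘ using (mkℚᵘ; *≡*)
import Data.Rational.Unnormalised.Properties as ℚᵘ
open import Data.Sum using (_⊎_; inj₁; inj₂; [_,_]′)
open import Function.Bundles using (_⇔_; mk⇔; Equivalence)
open import Level using (0ℓ)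
open import Relation.Binary.Definitions using (tri<; tri≈; tri>)
open import Relation.Binary.PropositionalEquality
  using (_≡_; _≢_; refl; sym; trans; cong; cong₂; subst; isEquivalence; module ≡-Reasoning)
  renaming (setoid to ≡-setoid)
import Relation.Binary.Reasoning.Setoid
open import Relation.Nullary using (¬_)
open import Relation.Nullary.Decidable using (Dec; yes; no; map′; _×-dec_)
open Equivalence using (to; from)

-- The field ℚ(√5) and its power series

module ℚSolver = Data.Rational.Solver.+-*-Solver

infix 4 _≟ₖ_

_≟ₖ_ : (x y : K) → Dec (x ≡ y)
(a ⊕ b √5) ≟ₖ (c ⊕ d √5) =
  map′ (λ { (refl , refl) → refl }) (λ { refl → refl , refl }) (a ℚ.≟ c ×-dec b ℚ.≟ d)

+ₖ-assoc : ∀ x y z → (x +ₖ y) +ₖ z ≡ x +ₖ (y +ₖ z)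
+ₖ-assoc (a ⊕ b √5) (c ⊕ d √5) (e ⊕ f √5) = cong₂ _⊕_√5 (ℚ.+-assoc a c e) (ℚ.+-assoc b d f)

+ₖ-comm : ∀ x y → x +ₖ y ≡ y +ₖ x
+ₖ-comm (a ⊕ b √5) (c ⊕ d √5) = cong₂ _⊕_√5 (ℚ.+-comm a c) (ℚ.+-comm b d)

+ₖ-identityˡ : ∀ x → 0ₖ +ₖ x ≡ x
+ₖ-identityˡ (a ⊕ b √5) = cong₂ _⊕_√5 (ℚ.+-identityˡ a) (ℚ.+-identityˡ b)

-ₖ-inverseˡ : ∀ x → (-ₖ x) +ₖ x ≡ 0ₖ
-ₖ-inverseˡ (a ⊕ b √5) = cong₂ _⊕_√5 (ℚ.+-inverseˡ a) (ℚ.+-inverseˡ b)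

*ₖ-comm : ∀ x y → x *ₖ y ≡ y *ₖ x
*ₖ-comm (a ⊕ b √5) (c ⊕ d √5) = cong₂ _⊕_√5
  (cong₂ ℚ._+_ (ℚ.*-comm a c) (cong ((+ 5 ℚ./ 1) ℚ.*_) (ℚ.*-comm b d)))
  (trans (ℚ.+-comm (a ℚ.* d) (b ℚ.* c)) (cong₂ ℚ._+_ (ℚ.*-comm b c) (ℚ.*-comm a d)))

*ₖ-identityˡ : ∀ x → 1ₖ *ₖ x ≡ x
*ₖ-identityˡ (a ⊕ b √5) = cong₂ _⊕_√5
  (solve 2 (λ a b → con 1ℚ :* a :+ con (+ 5 ℚ./ 1) :* (con 0ℚ :* b) := a) refl a b)
  (solve 2 (λ a b → con 1ℚ :* b :+ con 0ℚ :* a := b) refl a b)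
  where open ℚSolver

*ₖ-assoc : ∀ x y z → (x *ₖ y) *ₖ z ≡ x *ₖ (y *ₖ z)
*ₖ-assoc (a ⊕ b √5) (c ⊕ d √5) (e ⊕ f √5) = cong₂ _⊕_√5
  (solve 6 (λ a b c d e f →
     (a :* c :+ five :* (b :* d)) :* e :+ five :* ((a :* d :+ b :* c) :* f)
     := a :* (c :* e :+ five :* (d :* f)) :+ five :* (b :* (c :* f :+ d :* e))) refl a b c d e f)
  (solve 6 (λ a b c d e f →
     (a :* c :+ five :* (b :* d)) :* f :+ (a :* d :+ b :* c) :* e
     := a :* (c :* f :+ d :* e) :+ b :* (c :* e :+ five :* (d :* f))) refl a b c d e f)
  where
    open ℚSolver
    five : Polynomial 6
    five = con (+ 5 ℚ./ 1)

*ₖ-distribʳ : ∀ x y z → (y +ₖ z) *ₖ x ≡ y *ₖ x +ₖ z *ₖ x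
*ₖ-distribʳ (a ⊕ b √5) (c ⊕ d √5) (e ⊕ f √5) = cong₂ _⊕_√5
  (solve 6 (λ a b c d e f →
     (c :+ e) :* a :+ five :* ((d :+ f) :* b)
     := (c :* a :+ five :* (d :* b)) :+ (e :* a :+ five :* (f :* b))) refl a b c d e f)
  (solve 6 (λ a b c d e f →
     (c :+ e) :* b :+ (d :+ f) :* a
     := (c :* b :+ d :* a) :+ (e :* b :+ f :* a)) refl a b c d e f)
  where
    open ℚSolver
    five : Polynomial 6
    five = con (+ 5 ℚ./ 1)

K-isCommutativeRing : IsCommutativeRing _≡_ _+ₖ_ _*ₖ_ (λ x → -ₖ x) 0ₖ 1ₖ
K-isCommutativeRing = record
  { isRing = record
    { +-isAbelianGroup = record
      { isGroup = record
        { isMonoid = record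
          { isSemigroup = record
            { isMagma = record { isEquivalence = isEquivalence ; ∙-cong = cong₂ _+ₖ_ }
            ; assoc = +ₖ-assoc }
          ; identity = +ₖ-identityˡ , λ x → trans (+ₖ-comm x 0ₖ) (+ₖ-identityˡ x) }
        ; inverse = -ₖ-inverseˡ , λ x → trans (+ₖ-comm x (-ₖ x)) (-ₖ-inverseˡ x)
        ; ⁻¹-cong = cong (λ x → -ₖ x) }
      ; comm = +ₖ-comm }
    ; *-cong = cong₂ _*ₖ_
    ; *-assoc = *ₖ-assoc
    ; *-identity = *ₖ-identityˡ , λ x → trans (*ₖ-comm x 1ₖ) (*ₖ-identityˡ x)
    ; distrib = (λ x y z → trans (*ₖ-comm x (y +ₖ z)) (trans (*ₖ-distribʳ x y z)
                             (cong₂ _+ₖ_ (*ₖ-comm y x) (*ₖ-comm z x))))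
              , *ₖ-distribʳ }
  ; *-comm = *ₖ-comm }

K-commutativeRing : CommutativeRing 0ℓ 0ℓ
K-commutativeRing = record { isCommutativeRing = K-isCommutativeRing }

module Kᵣ = CommutativeRing K-commutativeRing
module KSolver = Algebra.Solver.Ring.Simple (fromCommutativeRing K-commutativeRing) _≟ₖ_

-- The ring of power series

tail : PS → PS
tail f n = f (suc n)

sumK-cong : ∀ m {g h : ℕ → K} → (∀ k → k ℕ.< m → g k ≡ h k) → sumK m g ≡ sumK m h
sumK-cong zero    e = refl
sumK-cong (suc m) e = cong₂ _+ₖ_ (sumK-cong m (λ k k<m → e k (ℕ.m≤n⇒m≤1+n k<m))) (e m ℕ.≤-refl)

sumK-head : ∀ m (h : ℕ → K) → sumK (suc m) h ≡ h 0 +ₖ sumK m (λ k → h (suc k))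
sumK-head zero    h = +ₖ-comm 0ₖ (h 0)
sumK-head (suc m) h = trans (cong (_+ₖ h (suc m)) (sumK-head m h)) (+ₖ-assoc (h 0) _ _)

*ₚ-coeff₀ : ∀ f g → (f *ₚ g) 0 ≡ f 0 *ₖ g 0
*ₚ-coeff₀ f g = +ₖ-identityˡ _

-- Splitting off the first or the last term of the convolution passes from index n + 1 to n, with
-- `tail` applied to one factor. Commutativity, distributivity and associativity are inductions
-- along these two recursions.
*ₚ-sucˡ : ∀ f g n → (f *ₚ g) (suc n) ≡ f 0 *ₖ g (suc n) +ₖ (tail f *ₚ g) n
*ₚ-sucˡ f g n = sumK-head (suc n) (λ k → f k *ₖ g (suc n ∸ k))

*ₚ-sucʳ : ∀ f g n → (f *ₚ g) (suc n) ≡ (f *ₚ tail g) n +ₖ f (suc n) *ₖ g 0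
*ₚ-sucʳ f g n = cong₂ _+ₖ_
  (sumK-cong (suc n) λ { k (s≤s k≤n) → cong (λ m → f k *ₖ g m) (ℕ.+-∸-assoc 1 k≤n) })
  (cong (λ m → f (suc n) *ₖ g m) (ℕ.n∸n≡0 n))

*ₚ-cong : ∀ {f f′ g g′} → f ≋ f′ → g ≋ g′ → f *ₚ g ≋ f′ *ₚ g′
*ₚ-cong p q n = sumK-cong (suc n) (λ k _ → cong₂ _*ₖ_ (p k) (q (n ∸ k)))

*ₚ-comm : ∀ f g → f *ₚ g ≋ g *ₚ f
*ₚ-comm f g zero    = cong (0ₖ +ₖ_) (*ₖ-comm (f 0) (g 0))
*ₚ-comm f g (suc n) = begin
  (f *ₚ g) (suc n)                       ≡⟨ *ₚ-sucˡ f g n ⟩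
  f 0 *ₖ g (suc n) +ₖ (tail f *ₚ g) n    ≡⟨ cong₂ _+ₖ_ (*ₖ-comm (f 0) _) (*ₚ-comm (tail f) g n) ⟩
  g (suc n) *ₖ f 0 +ₖ (g *ₚ tail f) n    ≡⟨ +ₖ-comm (g (suc n) *ₖ f 0) ((g *ₚ tail f) n) ⟩
  (g *ₚ tail f) n +ₖ g (suc n) *ₖ f 0    ≡⟨ *ₚ-sucʳ g f n ⟨
  (g *ₚ f) (suc n)                       ∎
  where open ≡-Reasoning

*ₚ-distribʳ : ∀ h f g → (f +ₚ g) *ₚ h ≋ (f *ₚ h) +ₚ (g *ₚ h)
*ₚ-distribʳ h f g zero =
  solve 3 (λ a b c → zr :+ (a :+ b) :* c := (zr :+ a :* c) :+ (zr :+ b :* c)) refl (f 0) (g 0) (h 0)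
  where
    open KSolver
    zr : Polynomial 3
    zr = con 0ₖ
*ₚ-distribʳ h f g (suc n) = begin
  ((f +ₚ g) *ₚ h) (suc n)
    ≡⟨ *ₚ-sucˡ (f +ₚ g) h n ⟩
  (f 0 +ₖ g 0) *ₖ h (suc n) +ₖ ((tail f +ₚ tail g) *ₚ h) n
    ≡⟨ cong ((f 0 +ₖ g 0) *ₖ h (suc n) +ₖ_) (*ₚ-distribʳ h (tail f) (tail g) n) ⟩
  (f 0 +ₖ g 0) *ₖ h (suc n) +ₖ ((tail f *ₚ h) n +ₖ (tail g *ₚ h) n)
    ≡⟨ solve 5 (λ a b c x y → (a :+ b) :* c :+ (x :+ y) := (a :* c :+ x) :+ (b :* c :+ y))
         refl (f 0) (g 0) (h (suc n)) _ _ ⟩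
  (f 0 *ₖ h (suc n) +ₖ (tail f *ₚ h) n) +ₖ (g 0 *ₖ h (suc n) +ₖ (tail g *ₚ h) n)
    ≡⟨ cong₂ _+ₖ_ (*ₚ-sucˡ f h n) (*ₚ-sucˡ g h n) ⟨
  ((f *ₚ h) +ₚ (g *ₚ h)) (suc n) ∎
  where
    open KSolver
    open ≡-Reasoning

-- Needed for associativity, where `tail (f *ₚ g)` is `scale (f 0) (tail g) +ₚ tail f *ₚ g`.
scale : K → PS → PS
scale c f n = c *ₖ f n

scale-*ₚ : ∀ c f g → scale c f *ₚ g ≋ scale c (f *ₚ g)
scale-*ₚ c f g zero    = solve 3 (λ c a b → con 0ₖ :+ (c :* a) :* b := c :* (con 0ₖ :+ a :* b)) refl c (f 0) (g 0)
  where open KSolver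
scale-*ₚ c f g (suc n) = begin
  (scale c f *ₚ g) (suc n)
    ≡⟨ *ₚ-sucˡ (scale c f) g n ⟩
  (c *ₖ f 0) *ₖ g (suc n) +ₖ (scale c (tail f) *ₚ g) n
    ≡⟨ cong ((c *ₖ f 0) *ₖ g (suc n) +ₖ_) (scale-*ₚ c (tail f) g n) ⟩
  (c *ₖ f 0) *ₖ g (suc n) +ₖ c *ₖ (tail f *ₚ g) n
    ≡⟨ solve 4 (λ c a b x → (c :* a) :* b :+ c :* x := c :* (a :* b :+ x)) refl c (f 0) (g (suc n)) _ ⟩
  c *ₖ (f 0 *ₖ g (suc n) +ₖ (tail f *ₚ g) n)
    ≡⟨ cong (c *ₖ_) (*ₚ-sucˡ f g n) ⟨
  scale c (f *ₚ g) (suc n) ∎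
  where
    open KSolver
    open ≡-Reasoning

*ₚ-assoc : ∀ f g h → (f *ₚ g) *ₚ h ≋ f *ₚ (g *ₚ h)
*ₚ-assoc f g h zero =
  solve 3 (λ a b c → zr :+ (zr :+ a :* b) :* c := zr :+ a :* (zr :+ b :* c)) refl (f 0) (g 0) (h 0)
  where
    open KSolver
    zr : Polynomial 3
    zr = con 0ₖ
*ₚ-assoc f g h (suc n) = begin
  ((f *ₚ g) *ₚ h) (suc n)
    ≡⟨ *ₚ-sucˡ (f *ₚ g) h n ⟩
  (f *ₚ g) 0 *ₖ h (suc n) +ₖ (tail (f *ₚ g) *ₚ h) n
    ≡⟨ cong₂ (λ x y → x *ₖ h (suc n) +ₖ y) (*ₚ-coeff₀ f g) (*ₚ-cong {g = h} (*ₚ-sucˡ f g) (λ _ → refl) n) ⟩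
  (f 0 *ₖ g 0) *ₖ h (suc n) +ₖ ((scale (f 0) (tail g) +ₚ (tail f *ₚ g)) *ₚ h) n
    ≡⟨ cong ((f 0 *ₖ g 0) *ₖ h (suc n) +ₖ_) (*ₚ-distribʳ h (scale (f 0) (tail g)) (tail f *ₚ g) n) ⟩
  (f 0 *ₖ g 0) *ₖ h (suc n) +ₖ ((scale (f 0) (tail g) *ₚ h) n +ₖ ((tail f *ₚ g) *ₚ h) n)
    ≡⟨ cong₂ (λ x y → (f 0 *ₖ g 0) *ₖ h (suc n) +ₖ (x +ₖ y))
         (scale-*ₚ (f 0) (tail g) h n) (*ₚ-assoc (tail f) g h n) ⟩
  (f 0 *ₖ g 0) *ₖ h (suc n) +ₖ (f 0 *ₖ (tail g *ₚ h) n +ₖ (tail f *ₚ (g *ₚ h)) n)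
    ≡⟨ solve 5 (λ a b c x y → (a :* b) :* c :+ (a :* x :+ y) := a :* (b :* c :+ x) :+ y)
         refl (f 0) (g 0) (h (suc n)) _ _ ⟩
  f 0 *ₖ (g 0 *ₖ h (suc n) +ₖ (tail g *ₚ h) n) +ₖ (tail f *ₚ (g *ₚ h)) n
    ≡⟨ cong (λ x → f 0 *ₖ x +ₖ (tail f *ₚ (g *ₚ h)) n) (*ₚ-sucˡ g h n) ⟨
  f 0 *ₖ (g *ₚ h) (suc n) +ₖ (tail f *ₚ (g *ₚ h)) n
    ≡⟨ *ₚ-sucˡ f (g *ₚ h) n ⟨
  (f *ₚ (g *ₚ h)) (suc n) ∎
  where
    open KSolver
    open ≡-Reasoning

zero-*ₚ : ∀ f g → (∀ n → f n ≡ 0ₖ) → ∀ n → (f *ₚ g) n ≡ 0ₖ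
zero-*ₚ f g f≋0 zero    = trans (*ₚ-coeff₀ f g) (trans (cong (_*ₖ g 0) (f≋0 0)) (Kᵣ.zeroˡ (g 0)))
zero-*ₚ f g f≋0 (suc n) = trans (*ₚ-sucˡ f g n) (trans
  (cong₂ _+ₖ_ (trans (cong (_*ₖ g (suc n)) (f≋0 0)) (Kᵣ.zeroˡ (g (suc n))))
              (zero-*ₚ (tail f) g (λ k → f≋0 (suc k)) n))
  (+ₖ-identityˡ 0ₖ))

const-*ₚ : ∀ c g n → (const c *ₚ g) n ≡ c *ₖ g n
const-*ₚ c g zero    = *ₚ-coeff₀ (const c) g
const-*ₚ c g (suc n) = trans (*ₚ-sucˡ (const c) g n)
  (trans (cong (c *ₖ g (suc n) +ₖ_) (zero-*ₚ (tail (const c)) g (λ _ → refl) n)) (Kᵣ.+-identityʳ _))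

*ₚ-identityˡ : ∀ f → const 1ₖ *ₚ f ≋ f
*ₚ-identityˡ f n = trans (const-*ₚ 1ₖ f n) (*ₖ-identityˡ (f n))

-ₚ_ : PS → PS
(-ₚ f) n = -ₖ f n

const-0 : ∀ n → const 0ₖ n ≡ 0ₖ
const-0 zero    = refl
const-0 (suc n) = refl

PS-isCommutativeRing : IsCommutativeRing _≋_ _+ₚ_ _*ₚ_ (λ f → -ₚ f) (const 0ₖ) (const 1ₖ)
PS-isCommutativeRing = record
  { isRing = record
    { +-isAbelianGroup = record
      { isGroup = record
        { isMonoid = record
          { isSemigroup = record
            { isMagma = record
              { isEquivalence = record
                { refl = λ _ → refl ; sym = λ p n → sym (p n) ; trans = λ p q n → trans (p n) (q n) }
              ; ∙-cong = λ p q n → cong₂ _+ₖ_ (p n) (q n) }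
            ; assoc = λ f g h n → +ₖ-assoc (f n) (g n) (h n) }
          ; identity = (λ f n → trans (cong (_+ₖ f n) (const-0 n)) (+ₖ-identityˡ (f n)))
                     , (λ f n → trans (cong (f n +ₖ_) (const-0 n)) (Kᵣ.+-identityʳ (f n))) }
        ; inverse = (λ f n → trans (-ₖ-inverseˡ (f n)) (sym (const-0 n)))
                  , (λ f n → trans (Kᵣ.-‿inverseʳ (f n)) (sym (const-0 n)))
        ; ⁻¹-cong = λ p n → cong (λ x → -ₖ x) (p n) }
      ; comm = λ f g n → +ₖ-comm (f n) (g n) }
    ; *-cong = *ₚ-cong
    ; *-assoc = *ₚ-assoc
    ; *-identity = *ₚ-identityˡ , λ f n → trans (*ₚ-comm f (const 1ₖ) n) (*ₚ-identityˡ f n)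
    ; distrib = (λ f g h n → trans (*ₚ-comm f (g +ₚ h) n) (trans (*ₚ-distribʳ f g h n)
                               (cong₂ _+ₖ_ (*ₚ-comm g f n) (*ₚ-comm h f n))))
              , *ₚ-distribʳ }
  ; *-comm = *ₚ-comm }

PS-commutativeRing : CommutativeRing 0ℓ 0ℓ
PS-commutativeRing = record { isCommutativeRing = PS-isCommutativeRing }

PS-almostCommutativeRing : AlmostCommutativeRing 0ℓ 0ℓ
PS-almostCommutativeRing = fromCommutativeRing PS-commutativeRing

-- Lets the ring solver take its coefficients from ℚ(√5), so that φ₊ + φ₋ = 1 and φ₊ φ₋ = -1 hold by
-- computation inside its normal forms.
const-morphism : CommutativeRing.rawRing K-commutativeRing -Raw-AlmostCommutative⟶ PS-almostCommutativeRing
const-morphism = record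
  { ⟦_⟧    = const
  ; +-homo = λ { a b zero → refl ; a b (suc n) → refl }
  ; *-homo = λ { a b zero → sym (*ₚ-coeff₀ (const a) (const b))
               ; a b (suc n) → sym (trans (const-*ₚ a (const b) (suc n)) (Kᵣ.zeroʳ a)) }
  ; -‿homo = λ { a zero → refl ; a (suc n) → refl }
  ; 0-homo = λ _ → refl
  ; 1-homo = λ _ → refl }

-- Closed form of the generating functions

φ : K → K
φ e = ofℚ ½ *ₖ (1ₖ +ₖ e)

φ₊ φ₋ : K
φ₊ = φ √5ₖ
φ₋ = φ (-ₖ √5ₖ)

-- R is abstract so that the solver's normal forms are compared without unfolding power series.
module KAlgebra
  (R : CommutativeRing 0ℓ 0ℓ)
  (ι : CommutativeRing.rawRing K-commutativeRing -Raw-AlmostCommutative⟶ fromCommutativeRing R)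
  where

  open CommutativeRing R renaming (refl to ≈-refl; sym to ≈-sym; trans to ≈-trans)
  open _-Raw-AlmostCommutative⟶_ ι using (⟦_⟧)
  open Relation.Binary.Reasoning.Setoid setoid
  open Algebra.Properties.Ring ring using (x∙y⁻¹≈ε⇒x≈y)

  private
    ⟦⟧-≟ : ∀ a b → Maybe (⟦ a ⟧ ≈ ⟦ b ⟧)
    ⟦⟧-≟ a b with a ≟ₖ b
    ... | yes a≡b = just (reflexive (cong ⟦_⟧ a≡b))
    ... | no  _   = nothing

  module Solver = Algebra.Solver.Ring (CommutativeRing.rawRing K-commutativeRing) (fromCommutativeRing R) ι ⟦⟧-≟
  open Solver using (solve; _:=_; _:+_; _:*_; _:-_; con; Polynomial)

  ≈⇒-≈0 : ∀ {x y} → x ≈ y → x - y ≈ 0#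
  ≈⇒-≈0 {x} {y} x≈y = ≈-trans (+-congʳ x≈y) (-‿inverseʳ y)

  -- The algebraic identities below follow from two known relations: cofactors p and q are
  -- exhibited, and the solver only has to check a polynomial identity.
  ideal-membership : ∀ {u v a b c d} p q → u - v ≈ p * (a - b) + q * (c - d) → a ≈ b → c ≈ d → u ≈ v
  ideal-membership {u} {v} {a} {b} {c} {d} p q eq a≈b c≈d = x∙y⁻¹≈ε⇒x≈y u v (begin
    u - v                       ≈⟨ eq ⟩
    p * (a - b) + q * (c - d)   ≈⟨ +-cong (*-congˡ (≈⇒-≈0 a≈b)) (*-congˡ (≈⇒-≈0 c≈d)) ⟩
    p * 0# + q * 0#             ≈⟨ +-cong (zeroʳ p) (zeroʳ q) ⟩
    0# + 0#                     ≈⟨ +-identityˡ 0# ⟩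
    0#                          ∎)

  private
    :1 : ∀ {n} → Polynomial n
    :1 = con 1ₖ

  -- The quadratic equations of r and t

  module _ (x s r : Carrier) where

    private
      -- For e = ±√5 and L = root − root′, −8 (e − 1) times the quadratic relation in question is
      -- (e − 1)² (s² − radicand′) + L (L − 2 (e − 1) s); recall that (e − 1)(e + 1) = 4.
      module _ (e : K) where
        α β : K
        α = -ₖ (ofℚ (+ 1 ℚ./ 8) *ₖ (e -ₖ 1ₖ))
        β = -ₖ (ofℚ (+ 1 ℚ./ 32) *ₖ (1ₖ +ₖ e))

        radicand′ root root′ cofactor : Carrier
        radicand′ = ⟦ 1ₖ ⟧ - ⟦ ofℕₖ 3 +ₖ e ⟧ * x + ⟦ ofℚ ½ *ₖ (ofℕₖ 3 -ₖ e) ⟧ * x * x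
        root      = ⟦ ofℕₖ 4 ⟧ * x * r
        root′     = ⟦ e -ₖ 1ₖ ⟧ * (⟦ 1ₖ ⟧ - s) - ⟦ 1ₖ +ₖ e ⟧ * x
        cofactor  = ⟦ β ⟧ * ((root - root′) - (⟦ e -ₖ 1ₖ ⟧ + ⟦ e -ₖ 1ₖ ⟧) * s)

        equation : (x s r : Polynomial 3) → Polynomial 3 × Polynomial 3
        equation x s r =
          let :root  = con (ofℕₖ 4) :* x :* r
              :root′ = con (e -ₖ 1ₖ) :* (:1 :- s) :- con (1ₖ +ₖ e) :* x
              :rad   = :1 :- con (ofℕₖ 3 +ₖ e) :* x :+ con (ofℚ ½ *ₖ (ofℕₖ 3 -ₖ e)) :* x :* x
          in x :* r :- x :* (x :* (:1 :+ r) :* (:1 :+ con (φ e) :* r))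
             := con α :* (s :* s :- :rad)
                :+ con β :* ((:root :- :root′) :- (con (e -ₖ 1ₖ) :+ con (e -ₖ 1ₖ)) :* s) :* (:root :- :root′)

    -- The defining relation involves r only through x r, and x times the quadratic equation is a
    -- polynomial in x and x r; the extra factor is removed later by `X-cancel`. The identity rests
    -- on e² = 5, which computes only for concrete e, hence one copy for each sign.
    x*quadratic₊ : s * s ≈ radicand′ √5ₖ → root √5ₖ ≈ root′ √5ₖ →
      x * r ≈ x * (x * (⟦ 1ₖ ⟧ + r) * (⟦ 1ₖ ⟧ + ⟦ φ₊ ⟧ * r))
    x*quadratic₊ = ideal-membership ⟦ α √5ₖ ⟧ (cofactor √5ₖ) (solve 3 (equation √5ₖ) ≈-refl x s r)

    x*quadratic₋ : s * s ≈ radicand′ (-ₖ √5ₖ) → root (-ₖ √5ₖ) ≈ root′ (-ₖ √5ₖ) →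
      x * r ≈ x * (x * (⟦ 1ₖ ⟧ + r) * (⟦ 1ₖ ⟧ + ⟦ φ₋ ⟧ * r))
    x*quadratic₋ = ideal-membership ⟦ α (-ₖ √5ₖ) ⟧ (cofactor (-ₖ √5ₖ))
      (solve 3 (equation (-ₖ √5ₖ)) ≈-refl x s r)

  -- Peeling from the front matches `sumℕ` and makes the shift from q + 1 to q definitional, since
  -- `suc q ∸ suc i` reduces to `q ∸ i`.
  Σ : ℕ → (ℕ → Carrier) → Carrier
  Σ zero    f = 0#
  Σ (suc m) f = f 0 + Σ m (λ i → f (suc i))

  Σ-cong : ∀ m {f g} → (∀ i → f i ≈ g i) → Σ m f ≈ Σ m g
  Σ-cong zero    eq = ≈-refl
  Σ-cong (suc m) eq = +-cong (eq 0) (Σ-cong m (λ i → eq (suc i)))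

  Σ-distrib-+ : ∀ m f g → Σ m (λ i → f i + g i) ≈ Σ m f + Σ m g
  Σ-distrib-+ zero    f g = ≈-sym (+-identityˡ 0#)
  Σ-distrib-+ (suc m) f g = ≈-trans (+-congˡ (Σ-distrib-+ m _ _))
    (solve 4 (λ a b c d → (a :+ b) :+ (c :+ d) := (a :+ c) :+ (b :+ d)) ≈-refl (f 0) (g 0) _ _)

  Σ-distribˡ-* : ∀ m a f → a * Σ m f ≈ Σ m (λ i → a * f i)
  Σ-distribˡ-* zero    a f = zeroʳ a
  Σ-distribˡ-* (suc m) a f = ≈-trans (distribˡ a _ _) (+-congˡ (Σ-distribˡ-* m a _))

  *-distrib-1+x*Σ : ∀ w x m f → w * (⟦ 1ₖ ⟧ + x * Σ m f) ≈ w + x * Σ m (λ i → w * f i)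
  *-distrib-1+x*Σ w x m f = ≈-trans
    (solve 3 (λ w x s → w :* (:1 :+ x :* s) := w :+ x :* (w :* s)) ≈-refl w x (Σ m f))
    (+-congˡ (*-congˡ (Σ-distribˡ-* m w f)))

  *-distrib-1+x*ΣΣ : ∀ w x p f h m g →
    w * (⟦ 1ₖ ⟧ + x * (Σ p f + h + Σ m g)) ≈ w + x * (Σ p (λ i → w * f i) + w * h + Σ m (λ i → w * g i))
  *-distrib-1+x*ΣΣ w x p f h m g = ≈-trans
    (solve 5 (λ w x s h s′ → w :* (:1 :+ x :* (s :+ h :+ s′)) := w :+ x :* (w :* s :+ w :* h :+ w :* s′))
      ≈-refl w x (Σ p f) h (Σ m g))
    (+-congˡ (*-congˡ (+-cong (+-congʳ (Σ-distribˡ-* p w f)) (Σ-distribˡ-* m w g))))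

  -- Solution of the recurrences for the states

  module Kernel (x r t : Carrier)
    (root-r : r ≈ x * (⟦ 1ₖ ⟧ + r) * (⟦ 1ₖ ⟧ + ⟦ φ₊ ⟧ * r))
    (root-t : t ≈ x * (⟦ 1ₖ ⟧ + t) * (⟦ 1ₖ ⟧ + ⟦ φ₋ ⟧ * t)) where

    λ₊ λ₋ G W : Carrier
    λ₊ = ⟦ 1ₖ ⟧ + ⟦ φ₊ ⟧ * r
    λ₋ = ⟦ 1ₖ ⟧ + ⟦ φ₋ ⟧ * t
    G  = (⟦ 1ₖ ⟧ + r) * (⟦ 1ₖ ⟧ + t)
    W  = ⟦ φ₊ ⟧ * (⟦ 1ₖ ⟧ + t) - ⟦ φ₋ ⟧ * (⟦ 1ₖ ⟧ + r)

    -- J and H are W times the generating functions of the states, which avoids division.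
    α β J B : ℕ → Carrier
    α zero    = ⟦ φ₊ ⟧ * G
    α (suc q) = λ₊ * α q
    β zero    = ⟦ -ₖ φ₋ ⟧ * G
    β (suc q) = λ₋ * β q
    J q = α q + β q
    B q = r * α q + t * β q

    H : ℕ → ℕ → Carrier
    H p q = J (suc q) + Σ p (λ _ → B q)

    -- `B q` is the increment of `H p q` in p, the same for every p. The relation of r gives r α q =
    -- x (1 + r) α (q + 1), and likewise for t and β.
    B-rec : ∀ q → B q ≈ x * (J (suc q) + B (suc q))
    B-rec q = ideal-membership (α q) (β q)
      (solve 5 (λ a b x r t →
         let l = :1 :+ con φ₊ :* r ; m = :1 :+ con φ₋ :* t in
         r :* a :+ t :* b :- x :* ((l :* a :+ m :* b) :+ (r :* (l :* a) :+ t :* (m :* b)))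
         := a :* (r :- x :* (:1 :+ r) :* l) :+ b :* (t :- x :* (:1 :+ t) :* m))
         ≈-refl (α q) (β q) x r t)
      root-r root-t

    -- This is the difference of two consecutive cases of `J-difference`, where only the top term of
    -- `ΣB` survives. The α part is α q times (λ₊ - 1)² - x λ₊ (λ₊ (λ₊ - 1) + r), which is φ₊² r
    -- times the relation of r because φ₊² = φ₊ + 1.
    J-second-difference : ∀ q →
      J (suc (suc q)) + J q + x * J (suc (suc q))
        ≈ J (suc q) + J (suc q) + x * (J (suc (suc (suc q))) + B (suc q))
    J-second-difference q = ideal-membership (⟦ φ₊ *ₖ φ₊ ⟧ * r * α q) (⟦ φ₋ *ₖ φ₋ ⟧ * t * β q)
      (solve 5 (λ a b x r t →
         let l = :1 :+ con φ₊ :* r ; m = :1 :+ con φ₋ :* t in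
         ((l :* (l :* a) :+ m :* (m :* b)) :+ (a :+ b) :+ x :* (l :* (l :* a) :+ m :* (m :* b)))
         :- ((l :* a :+ m :* b) :+ (l :* a :+ m :* b)
             :+ x :* ((l :* (l :* (l :* a)) :+ m :* (m :* (m :* b))) :+ (r :* (l :* a) :+ t :* (m :* b))))
         := con (φ₊ *ₖ φ₊) :* r :* a :* (r :- x :* (:1 :+ r) :* l)
            :+ con (φ₋ *ₖ φ₋) :* t :* b :* (t :- x :* (:1 :+ t) :* m))
         ≈-refl (α q) (β q) x r t)
      root-r root-t

    -- The relation of r amounts to (1 + r)(1 - x λ₊) = 1, so φ₊ G (1 - x λ₊) collapses to φ₊ (1 +
    -- t). With the conjugate term this leaves exactly W.
    J₀ : J 0 ≈ W + x * J 1
    J₀ = ideal-membership (⟦ φ₊ ⟧ * (⟦ 1ₖ ⟧ + t)) (⟦ -ₖ φ₋ ⟧ * (⟦ 1ₖ ⟧ + r))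
      (solve 3 (λ x r t →
         let l = :1 :+ con φ₊ :* r ; m = :1 :+ con φ₋ :* t
             G = (:1 :+ r) :* (:1 :+ t)
             a = con φ₊ :* G ; b = con (-ₖ φ₋) :* G in
         (a :+ b) :- ((con φ₊ :* (:1 :+ t) :- con φ₋ :* (:1 :+ r)) :+ x :* (l :* a :+ m :* b))
         := con φ₊ :* (:1 :+ t) :* (r :- x :* (:1 :+ r) :* l)
            :+ con (-ₖ φ₋) :* (:1 :+ r) :* (t :- x :* (:1 :+ t) :* m))
         ≈-refl x r t)
      root-r root-t

    -- Here λ₊² + r = φ₊ (1 + r) λ₊ + φ₋, and the cofactor λ₊ - φ₋ equals φ₊ (1 + r). The leftover
    -- terms x φ₊ φ₋ G of the two conjugate parts cancel because of the sign in `β 0`.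
    J₁ : J 1 ≈ J 0 + x * (J 2 + B 0)
    J₁ = ideal-membership (⟦ φ₊ ⟧ * (⟦ 1ₖ ⟧ + t) * (λ₊ - ⟦ φ₋ ⟧))
      (⟦ -ₖ φ₋ ⟧ * (⟦ 1ₖ ⟧ + r) * (λ₋ - ⟦ φ₊ ⟧))
      (solve 3 (λ x r t →
         let l = :1 :+ con φ₊ :* r ; m = :1 :+ con φ₋ :* t
             G = (:1 :+ r) :* (:1 :+ t)
             a = con φ₊ :* G ; b = con (-ₖ φ₋) :* G in
         (l :* a :+ m :* b) :- ((a :+ b) :+ x :* ((l :* (l :* a) :+ m :* (m :* b)) :+ (r :* a :+ t :* b)))
         := con φ₊ :* (:1 :+ t) :* (l :- con φ₋) :* (r :- x :* (:1 :+ r) :* l)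
            :+ con (-ₖ φ₋) :* (:1 :+ r) :* (m :- con φ₊) :* (t :- x :* (:1 :+ t) :* m))
         ≈-refl x r t)
      root-r root-t

    ΣB : ℕ → Carrier
    ΣB q = Σ (suc q) (λ i → B (q ∸ i))

    -- The difference of consecutive cases of `J-children`, obtained by summing second differences
    -- from the initial case `J₁`.
    J-difference : ∀ q → J (suc q) ≈ J q + x * (J (suc (suc q)) + ΣB q)
    J-difference zero    = ≈-trans J₁ (+-congˡ (*-congˡ (+-congˡ (≈-sym (+-identityʳ (B 0))))))
    J-difference (suc q) = ideal-membership ⟦ 1ₖ ⟧ ⟦ 1ₖ ⟧
      (solve 7 (λ x J₀ J₁ J₂ J₃ B₁ T →
         J₂ :- (J₁ :+ x :* (J₃ :+ (B₁ :+ T)))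
         := con 1ₖ :* (J₂ :+ J₀ :+ x :* J₂ :- (J₁ :+ J₁ :+ x :* (J₃ :+ B₁)))
            :+ con 1ₖ :* (J₁ :- (J₀ :+ x :* (J₂ :+ T))))
         ≈-refl x (J q) (J (suc q)) (J (suc (suc q))) (J (suc (suc (suc q)))) (B (suc q)) (ΣB q))
      (J-second-difference q) (J-difference q)

    ΣH : ℕ → Carrier
    ΣH q = Σ (suc q) (λ i → H i (q ∸ i))

    ΣH-suc : ∀ q → Σ (suc q) (λ i → H (suc i) (q ∸ i)) ≈ ΣH q + ΣB q
    ΣH-suc q = ≈-trans
      (Σ-cong (suc q) (λ i → solve 3 (λ j b h → j :+ (b :+ h) := (j :+ h) :+ b) ≈-refl
        (J (suc (q ∸ i))) (B (q ∸ i)) (Σ i (λ _ → B (q ∸ i)))))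
      (Σ-distrib-+ (suc q) (λ i → H i (q ∸ i)) (λ i → B (q ∸ i)))

    -- Passing from q to q + 1 adds the child `H 0 (q + 1)`, which is J (q + 2), and raises the
    -- first index of every other child by one, which adds `ΣB q`. This is the increment in
    -- `J-difference`.
    J-children : ∀ q → J q ≈ W + x * ΣH q
    J-children zero    = ≈-trans J₀ (+-congˡ (*-congˡ (≈-sym (≈-trans (+-identityʳ _) (+-identityʳ _)))))
    J-children (suc q) = begin
      J (suc q)                                              ≈⟨ J-difference q ⟩
      J q + x * (J (suc (suc q)) + ΣB q)                     ≈⟨ +-congʳ (J-children q) ⟩
      (W + x * ΣH q) + x * (J (suc (suc q)) + ΣB q)
        ≈⟨ solve 5 (λ w x s j b → (w :+ x :* s) :+ x :* (j :+ b) := w :+ x :* (j :+ (s :+ b)))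
             ≈-refl W x (ΣH q) _ (ΣB q) ⟩
      W + x * (J (suc (suc q)) + (ΣH q + ΣB q))
        ≈⟨ +-congˡ (*-congˡ (+-cong (+-identityʳ (J (suc (suc q)))) (ΣH-suc q))) ⟨
      W + x * ΣH (suc q)                                     ∎

    ΣB-rec : ∀ q p → Σ p (λ _ → B q) ≈ x * (Σ p (λ _ → J (suc q)) + Σ p (λ _ → B (suc q)))
    ΣB-rec q p = begin
      Σ p (λ _ → B q)                                           ≈⟨ Σ-cong p (λ _ → B-rec q) ⟩
      Σ p (λ _ → x * (J (suc q) + B (suc q)))                   ≈⟨ Σ-distribˡ-* p x _ ⟨
      x * Σ p (λ _ → J (suc q) + B (suc q))                     ≈⟨ *-congˡ (Σ-distrib-+ p _ _) ⟩
      x * (Σ p (λ _ → J (suc q)) + Σ p (λ _ → B (suc q)))       ∎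

    -- The summand J (q + 1) supplies W, J (q + 2) and the children of type `H (i + 1) (q − i)`; the
    -- p copies of `B-rec` supply p times J (q + 1) and turn J (q + 2) into `H p (q + 1)`.
    H-children : ∀ p q →
      H p q ≈ W + x * (Σ p (λ _ → J (suc q)) + H p (suc q) + Σ (suc q) (λ i → H (suc i) (q ∸ i)))
    H-children p q = begin
      J (suc q) + Σ p (λ _ → B q)
        ≈⟨ +-cong (J-children (suc q)) (ΣB-rec q p) ⟩
      (W + x * (J (suc (suc q)) + 0# + S)) + x * (P + P′)
        ≈⟨ solve 6 (λ w x j s p p′ → (w :+ x :* (j :+ s)) :+ x :* (p :+ p′)
                                    := w :+ x :* (p :+ (j :+ p′) :+ s))
             ≈-refl W x (J (suc (suc q)) + 0#) S P P′ ⟩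
      W + x * (P + ((J (suc (suc q)) + 0#) + P′) + S)
        ≈⟨ +-congˡ (*-congˡ (+-congʳ (+-congˡ (+-congʳ (+-identityʳ _))))) ⟩
      W + x * (P + H p (suc q) + S) ∎
      where
        S P P′ : Carrier
        S  = Σ (suc q) (λ i → H (suc i) (q ∸ i))
        P  = Σ p (λ _ → J (suc q))
        P′ = Σ p (λ _ → B (suc q))

    -- The claimed formula with denominators cleared: `D` is x r t (1 + 1/r + 1/t - 1/x).
    -- Conjugation, which swaps r with t and φ₊ with φ₋, negates W and J 0 and fixes `D`, so the
    -- second cofactor is minus the conjugate of the first.
    generating-function : ∀ {F} → W * F ≈ J 0 →
      W * ((F - ⟦ 1ₖ ⟧) * (x * r * t + x * t + x * r - r * t)) ≈ W * (x * r * t * (⟦ 1ₖ ⟧ + r * t))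
    generating-function {F} WF≈J₀ = begin
      W * ((F - ⟦ 1ₖ ⟧) * D)
        ≈⟨ solve 3 (λ w f d → w :* ((f :- :1) :* d) := (w :* f :- w) :* d) ≈-refl W F D ⟩
      (W * F - W) * D
        ≈⟨ *-congʳ (+-congʳ WF≈J₀) ⟩
      (J 0 - W) * D
        ≈⟨ ideal-membership (⟦ φ₋ ⟧ * t * t * (⟦ 1ₖ ⟧ + ⟦ φ₋ ⟧ * r))
             (⟦ -ₖ φ₊ ⟧ * r * r * (⟦ 1ₖ ⟧ + ⟦ φ₊ ⟧ * t))
             (solve 3 (λ x r t →
               let l = :1 :+ con φ₊ :* r ; m = :1 :+ con φ₋ :* t
                   G = (:1 :+ r) :* (:1 :+ t)
                   a = con φ₊ :* G ; b = con (-ₖ φ₋) :* G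
                   w = con φ₊ :* (:1 :+ t) :- con φ₋ :* (:1 :+ r) in
               ((a :+ b) :- w) :* (x :* r :* t :+ x :* t :+ x :* r :- r :* t)
               :- w :* (x :* r :* t :* (:1 :+ r :* t))
               := con φ₋ :* t :* t :* (:1 :+ con φ₋ :* r) :* (r :- x :* (:1 :+ r) :* l)
                  :+ con (-ₖ φ₊) :* r :* r :* (:1 :+ con φ₊ :* t) :* (t :- x :* (:1 :+ t) :* m))
               ≈-refl x r t)
             root-r root-t ⟩
      W * (x * r * t * (⟦ 1ₖ ⟧ + r * t)) ∎
      where
        D : Carrier
        D = x * r * t + x * t + x * r - r * t

-- Counting the tree of avoiders

sumℕ : ℕ → (ℕ → ℕ) → ℕ
sumℕ zero    f = 0
sumℕ (suc m) f = f 0 ℕ.+ sumℕ m (λ i → f (suc i))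

-- The number of nodes d levels below the states J q and H p q.
countJ : ℕ → ℕ → ℕ
countH : ℕ → ℕ → ℕ → ℕ
countJ q zero    = 1
countJ q (suc d) = sumℕ (suc q) (λ i → countH i (q ∸ i) d)
countH p q zero    = 1
countH p q (suc d) = sumℕ p (λ _ → countJ (suc q) d) ℕ.+ countH p (suc q) d
                     ℕ.+ sumℕ (suc q) (λ i → countH (suc i) (q ∸ i) d)

-- Division normalises the fraction and does not compute on variables, so additivity is checked on
-- unnormalised fractions.
/1-homo-+ : ∀ m n → + (m ℕ.+ n) ℚ./ 1 ≡ (+ m ℚ./ 1) ℚ.+ (+ n ℚ./ 1)
/1-homo-+ m n = ℚ.toℚᵘ-injective (begin
  toℚᵘ (+ (m ℕ.+ n) ℚ./ 1)                  ≈⟨ ℚ.toℚᵘ-fromℚᵘ (mkℚᵘ (+ (m ℕ.+ n)) 0) ⟩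
  mkℚᵘ (+ (m ℕ.+ n)) 0
    ≈⟨ *≡* (cong (ℤ._* (+ 1)) (cong₂ ℤ._+_ (ℤ.*-identityʳ (+ m)) (ℤ.*-identityʳ (+ n)))) ⟨
  mkℚᵘ (+ m) 0 ℚᵘ.+ mkℚᵘ (+ n) 0
    ≈⟨ ℚᵘ.+-cong (ℚ.toℚᵘ-fromℚᵘ (mkℚᵘ (+ m) 0)) (ℚ.toℚᵘ-fromℚᵘ (mkℚᵘ (+ n) 0)) ⟨
  toℚᵘ (+ m ℚ./ 1) ℚᵘ.+ toℚᵘ (+ n ℚ./ 1)    ≈⟨ ℚ.toℚᵘ-homo-+ (+ m ℚ./ 1) (+ n ℚ./ 1) ⟨
  toℚᵘ ((+ m ℚ./ 1) ℚ.+ (+ n ℚ./ 1))        ∎)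
  where open Relation.Binary.Reasoning.Setoid ℚᵘ.≃-setoid

ofℕₖ-homo-+ : ∀ m n → ofℕₖ (m ℕ.+ n) ≡ ofℕₖ m +ₖ ofℕₖ n
ofℕₖ-homo-+ m n = cong (λ q → q ⊕ 0ℚ √5) (/1-homo-+ m n)

open KAlgebra PS-commutativeRing const-morphism
module PSR = CommutativeRing PS-commutativeRing

-- Comparing coefficients of power series

X-coeff₀ : ∀ f → (X *ₚ f) 0 ≡ 0ₖ
X-coeff₀ f = trans (*ₚ-coeff₀ X f) (Kᵣ.zeroˡ (f 0))

tail-X : tail X ≋ const 1ₖ
tail-X zero    = refl
tail-X (suc n) = refl

X-coeff-suc : ∀ f n → (X *ₚ f) (suc n) ≡ f n
X-coeff-suc f n = begin
  (X *ₚ f) (suc n)                       ≡⟨ *ₚ-sucˡ X f n ⟩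
  0ₖ *ₖ f (suc n) +ₖ (tail X *ₚ f) n     ≡⟨ cong₂ _+ₖ_ (Kᵣ.zeroˡ (f (suc n))) (*ₚ-cong {g = f} tail-X (λ _ → refl) n) ⟩
  0ₖ +ₖ (const 1ₖ *ₚ f) n                ≡⟨ +ₖ-identityˡ _ ⟩
  (const 1ₖ *ₚ f) n                      ≡⟨ *ₚ-identityˡ f n ⟩
  f n                                    ∎
  where open ≡-Reasoning

X-cancel : ∀ {f g} → X *ₚ f ≋ X *ₚ g → f ≋ g
X-cancel {f} {g} eq n = trans (sym (X-coeff-suc f n)) (trans (eq (suc n)) (X-coeff-suc g n))

-- Invertibility of `w 0` forces f 0 = 0; the last convolution term then drops out, so `w *ₚ tail f`
-- vanishes as well and the argument repeats. This replaces division by W.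
unit-coeff₀⇒nonZeroDivisor : ∀ {w} v f → v *ₖ w 0 ≡ 1ₖ → (∀ n → (w *ₚ f) n ≡ 0ₖ) → ∀ n → f n ≡ 0ₖ
unit-coeff₀⇒nonZeroDivisor {w} v f vw₀≡1 wf≡0 = λ where
    zero    → f₀≡0
    (suc n) → unit-coeff₀⇒nonZeroDivisor {w} v (tail f) vw₀≡1 w*tail-f≡0 n
  where
    open ≡-Reasoning
    f₀≡0 : f 0 ≡ 0ₖ
    f₀≡0 = begin
      f 0                 ≡⟨ *ₖ-identityˡ (f 0) ⟨
      1ₖ *ₖ f 0           ≡⟨ cong (_*ₖ f 0) vw₀≡1 ⟨
      v *ₖ w 0 *ₖ f 0     ≡⟨ *ₖ-assoc v (w 0) (f 0) ⟩
      v *ₖ (w 0 *ₖ f 0)   ≡⟨ cong (v *ₖ_) (trans (sym (*ₚ-coeff₀ w f)) (wf≡0 0)) ⟩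
      v *ₖ 0ₖ             ≡⟨ Kᵣ.zeroʳ v ⟩
      0ₖ                  ∎
    w*tail-f≡0 : ∀ n → (w *ₚ tail f) n ≡ 0ₖ
    w*tail-f≡0 n = begin
      (w *ₚ tail f) n                            ≡⟨ Kᵣ.+-identityʳ _ ⟨
      (w *ₚ tail f) n +ₖ 0ₖ                      ≡⟨ cong ((w *ₚ tail f) n +ₖ_) w*f₀≡0 ⟨
      (w *ₚ tail f) n +ₖ w (suc n) *ₖ f 0        ≡⟨ *ₚ-sucʳ w f n ⟨
      (w *ₚ f) (suc n)                           ≡⟨ wf≡0 (suc n) ⟩
      0ₖ                                         ∎
      where
        w*f₀≡0 : w (suc n) *ₖ f 0 ≡ 0ₖ
        w*f₀≡0 = trans (cong (w (suc n) *ₖ_) f₀≡0) (Kᵣ.zeroʳ (w (suc n)))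

unit-coeff₀⇒cancelˡ : ∀ {w} v {f g} → v *ₖ w 0 ≡ 1ₖ → w *ₚ f ≋ w *ₚ g → f ≋ g
unit-coeff₀⇒cancelˡ {w} v {f} {g} vw₀≡1 wf≋wg = x∙y⁻¹≈ε⇒x≈y f g
    λ n → trans (unit-coeff₀⇒nonZeroDivisor {w} v (f PSR.- g) vw₀≡1 vanishes n) (sym (const-0 n))
  where
    open import Algebra.Properties.Ring PSR.ring using (x∙y⁻¹≈ε⇒x≈y; x[y-z]≈xy-xz)
    vanishes : ∀ n → (w *ₚ (f PSR.- g)) n ≡ 0ₖ
    vanishes n = trans (x[y-z]≈xy-xz w f g n)
      (trans (cong (_+ₖ (-ₖ (w *ₚ g) n)) (wf≋wg n)) (Kᵣ.-‿inverseʳ ((w *ₚ g) n)))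

Σ-coeff-cong : ∀ m (f g : ℕ → PS) n → (∀ i → f i n ≡ g i n) → Σ m f n ≡ Σ m g n
Σ-coeff-cong zero    f g n eq = refl
Σ-coeff-cong (suc m) f g n eq = cong₂ _+ₖ_ (eq 0) (Σ-coeff-cong m _ _ n (λ i → eq (suc i)))

ofSeq-sum : ∀ m (f : ℕ → ℕ → ℕ) n → ofℕₖ (sumℕ m (λ i → f i n)) ≡ Σ m (λ i → ofSeq (f i)) n
ofSeq-sum zero    f n = sym (const-0 n)
ofSeq-sum (suc m) f n = trans (ofℕₖ-homo-+ (f 0 n) _) (cong (ofℕₖ (f 0 n) +ₖ_) (ofSeq-sum m (λ i → f (suc i)) n))

ofSeq-step : ∀ a S → a 0 ≡ 1 → (∀ n → ofℕₖ (a (suc n)) ≡ S n) → ofSeq a ≋ const 1ₖ +ₚ X *ₚ S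
ofSeq-step a S a₀ step zero    = trans (cong ofℕₖ a₀) (sym (cong (1ₖ +ₖ_) (X-coeff₀ S)))
ofSeq-step a S a₀ step (suc n) = trans (step n) (sym (trans (+ₖ-identityˡ _) (X-coeff-suc S n)))

-- The factor X makes coefficient n + 1 depend only on coefficient n of the children, so the system
-- of equations determines its solution one coefficient at a time.
step-coeff : ∀ {f g} w S T → f ≋ w +ₚ X *ₚ S → g ≋ w +ₚ X *ₚ T → ∀ n → S n ≡ T n → f (suc n) ≡ g (suc n)
step-coeff w S T f≋ g≋ n eq =
  trans (f≋ (suc n)) (trans
    (cong (w (suc n) +ₖ_) (trans (X-coeff-suc S n) (trans eq (sym (X-coeff-suc T n)))))
    (sym (g≋ (suc n))))

step-coeff₀ : ∀ {f g} w S T → f ≋ w +ₚ X *ₚ S → g ≋ w +ₚ X *ₚ T → f 0 ≡ g 0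
step-coeff₀ w S T f≋ g≋ =
  trans (f≋ 0) (trans (cong (w 0 +ₖ_) (trans (X-coeff₀ S) (sym (X-coeff₀ T)))) (sym (g≋ 0)))

-- Lowest coefficients of the roots

IsQuadraticRoot : K → PS → Set
IsQuadraticRoot c r = r ≋ X *ₚ (const 1ₖ +ₚ r) *ₚ (const 1ₖ +ₚ const c *ₚ r)

root-coeff₀ : ∀ c {r} → IsQuadraticRoot c r → r 0 ≡ 0ₖ
root-coeff₀ c {r} root = begin
  r 0                               ≡⟨ root 0 ⟩
  (X *ₚ (const 1ₖ +ₚ r) *ₚ w) 0     ≡⟨ *ₚ-coeff₀ (X *ₚ (const 1ₖ +ₚ r)) w ⟩
  (X *ₚ (const 1ₖ +ₚ r)) 0 *ₖ w 0   ≡⟨ cong (_*ₖ w 0) (X-coeff₀ (const 1ₖ +ₚ r)) ⟩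
  0ₖ *ₖ w 0                         ≡⟨ Kᵣ.zeroˡ (w 0) ⟩
  0ₖ                                ∎
  where
    open ≡-Reasoning
    w : PS
    w = const 1ₖ +ₚ const c *ₚ r

root-coeff₁ : ∀ c {r} → IsQuadraticRoot c r → r 1 ≡ 1ₖ
root-coeff₁ c {r} root = begin
  r 1                                 ≡⟨ root 1 ⟩
  (X *ₚ v *ₚ w) 1                     ≡⟨ *ₚ-assoc X v w 1 ⟩
  (X *ₚ (v *ₚ w)) 1                   ≡⟨ X-coeff-suc (v *ₚ w) 0 ⟩
  (v *ₚ w) 0                          ≡⟨ *ₚ-coeff₀ v w ⟩
  v 0 *ₖ w 0                          ≡⟨ cong (λ z → v 0 *ₖ (1ₖ +ₖ z)) (const-*ₚ c r 0) ⟩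
  (1ₖ +ₖ r 0) *ₖ (1ₖ +ₖ c *ₖ r 0)     ≡⟨ cong (λ z → (1ₖ +ₖ z) *ₖ (1ₖ +ₖ c *ₖ z)) (root-coeff₀ c root) ⟩
  (1ₖ +ₖ 0ₖ) *ₖ (1ₖ +ₖ c *ₖ 0ₖ)       ≡⟨ cong (λ z → (1ₖ +ₖ 0ₖ) *ₖ (1ₖ +ₖ z)) (Kᵣ.zeroʳ c) ⟩
  1ₖ                                  ∎
  where
    open ≡-Reasoning
    v w : PS
    v = const 1ₖ +ₚ r
    w = const 1ₖ +ₚ const c *ₚ r

*ₚ-coeff₂ : ∀ f g → f 0 ≡ 0ₖ → g 0 ≡ 0ₖ → (f *ₚ g) 2 ≡ f 1 *ₖ g 1
*ₚ-coeff₂ f g f₀≡0 g₀≡0 = begin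
  (f *ₚ g) 2
    ≡⟨ cong₂ (λ a b → ((0ₖ +ₖ a *ₖ g 2) +ₖ f 1 *ₖ g 1) +ₖ f 2 *ₖ b) f₀≡0 g₀≡0 ⟩
  ((0ₖ +ₖ 0ₖ *ₖ g 2) +ₖ f 1 *ₖ g 1) +ₖ f 2 *ₖ 0ₖ
    ≡⟨ solve 4 (λ a b c d → ((con 0ₖ :+ con 0ₖ :* a) :+ b :* c) :+ d :* con 0ₖ := b :* c)
         refl (g 2) (f 1) (g 1) (f 2) ⟩
  f 1 *ₖ g 1 ∎
  where
    open ≡-Reasoning
    open KSolver

1ₖ≢0ₖ : ¬ 1ₖ ≡ 0ₖ
1ₖ≢0ₖ ()

-- Power series of the counts

module _ {r t : PS} (root-r : IsQuadraticRoot φ₊ r) (root-t : IsQuadraticRoot φ₋ t) where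

  open Kernel X r t root-r root-t

  CJ : ℕ → PS
  CJ q = ofSeq (countJ q)

  CH : ℕ → ℕ → PS
  CH p q = ofSeq (countH p q)

  SJ : ℕ → PS
  SJ q = Σ (suc q) (λ i → W *ₚ CH i (q ∸ i))

  SH TH : ℕ → ℕ → PS
  SH p q = Σ p (λ _ → W *ₚ CJ (suc q)) +ₚ W *ₚ CH p (suc q) +ₚ Σ (suc q) (λ i → W *ₚ CH (suc i) (q ∸ i))
  TH p q = Σ p (λ _ → J (suc q)) +ₚ H p (suc q) +ₚ Σ (suc q) (λ i → H (suc i) (q ∸ i))

  W*CJ : ∀ q → W *ₚ CJ q ≋ W +ₚ X *ₚ SJ q
  W*CJ q = PSR.trans
    (*ₚ-cong {W} (λ _ → refl) (ofSeq-step (countJ q) _ refl (ofSeq-sum (suc q) (λ i → countH i (q ∸ i)))))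
    (*-distrib-1+x*Σ W X (suc q) (λ i → CH i (q ∸ i)))

  W*CH : ∀ p q → W *ₚ CH p q ≋ W +ₚ X *ₚ SH p q
  W*CH p q = PSR.trans
    (*ₚ-cong {W} (λ _ → refl) (ofSeq-step (countH p q) (S₁ +ₚ CH p (suc q) +ₚ S₂) refl coeff))
    (*-distrib-1+x*ΣΣ W X p (λ _ → CJ (suc q)) (CH p (suc q)) (suc q) (λ i → CH (suc i) (q ∸ i)))
    where
      S₁ S₂ : PS
      S₁ = Σ p (λ _ → CJ (suc q))
      S₂ = Σ (suc q) (λ i → CH (suc i) (q ∸ i))
      coeff : ∀ n → ofℕₖ (countH p q (suc n)) ≡ (S₁ +ₚ CH p (suc q) +ₚ S₂) n
      coeff n = trans (ofℕₖ-homo-+ (sumℕ p (λ _ → countJ (suc q) n) ℕ.+ countH p (suc q) n) _)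
        (cong₂ _+ₖ_ (trans (ofℕₖ-homo-+ (sumℕ p (λ _ → countJ (suc q) n)) _)
                           (cong (_+ₖ CH p (suc q) n) (ofSeq-sum p (λ _ → countJ (suc q)) n)))
                    (ofSeq-sum (suc q) (λ i → countH (suc i) (q ∸ i)) n))

  -- Counts and closed forms satisfy the same recursion. The induction is on the coefficient index,
  -- for all states at once, because q can grow from a state to its child.
  W*CJ≋J : ∀ n q → (W *ₚ CJ q) n ≡ J q n
  W*CH≋H : ∀ n p q → (W *ₚ CH p q) n ≡ H p q n
  W*CJ≋J zero    q = step-coeff₀ W (SJ q) (ΣH q) (W*CJ q) (J-children q)
  W*CJ≋J (suc n) q = step-coeff W (SJ q) (ΣH q) (W*CJ q) (J-children q) n
    (Σ-coeff-cong (suc q) (λ i → W *ₚ CH i (q ∸ i)) (λ i → H i (q ∸ i)) n (λ i → W*CH≋H n i (q ∸ i)))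
  W*CH≋H zero    p q = step-coeff₀ W (SH p q) (TH p q) (W*CH p q) (H-children p q)
  W*CH≋H (suc n) p q = step-coeff W (SH p q) (TH p q) (W*CH p q) (H-children p q) n
    (cong₂ _+ₖ_
      (cong₂ _+ₖ_ (Σ-coeff-cong p (λ _ → W *ₚ CJ (suc q)) (λ _ → J (suc q)) n (λ _ → W*CJ≋J n (suc q)))
                  (W*CH≋H n p (suc q)))
      (Σ-coeff-cong (suc q) (λ i → W *ₚ CH (suc i) (q ∸ i)) (λ i → H (suc i) (q ∸ i)) n
        (λ i → W*CH≋H n (suc i) (q ∸ i))))

  -- Both r and t begin with x, so the coefficient of x² is 0 + 1 + 1 - 1.
  kernel-denominator≢0 : NonZeroPS (X *ₚ r *ₚ t +ₚ X *ₚ t +ₚ X *ₚ r -ₚ r *ₚ t)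
  kernel-denominator≢0 = 2 , λ D₂≡0 → 1ₖ≢0ₖ (trans (sym D₂≡1) D₂≡0)
    where
      open ≡-Reasoning
      D₂≡1 : (X *ₚ r *ₚ t +ₚ X *ₚ t +ₚ X *ₚ r -ₚ r *ₚ t) 2 ≡ 1ₖ
      D₂≡1 = begin
        (X *ₚ r *ₚ t) 2 +ₖ (X *ₚ t) 2 +ₖ (X *ₚ r) 2 +ₖ (-ₖ (r *ₚ t) 2)
          ≡⟨ cong₂ (λ a b → a +ₖ (X *ₚ t) 2 +ₖ (X *ₚ r) 2 +ₖ (-ₖ b))
               (*ₚ-coeff₂ (X *ₚ r) t (X-coeff₀ r) t₀≡0) (*ₚ-coeff₂ r t r₀≡0 t₀≡0) ⟩
        (X *ₚ r) 1 *ₖ t 1 +ₖ (X *ₚ t) 2 +ₖ (X *ₚ r) 2 +ₖ (-ₖ (r 1 *ₖ t 1))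
          ≡⟨ cong (λ a → a *ₖ t 1 +ₖ (X *ₚ t) 2 +ₖ (X *ₚ r) 2 +ₖ (-ₖ (r 1 *ₖ t 1)))
               (trans (X-coeff-suc r 0) r₀≡0) ⟩
        0ₖ *ₖ t 1 +ₖ (X *ₚ t) 2 +ₖ (X *ₚ r) 2 +ₖ (-ₖ (r 1 *ₖ t 1))
          ≡⟨ cong₂ (λ a b → 0ₖ *ₖ t 1 +ₖ a +ₖ b +ₖ (-ₖ (r 1 *ₖ t 1))) (X-coeff-suc t 1) (X-coeff-suc r 1) ⟩
        0ₖ *ₖ t 1 +ₖ t 1 +ₖ r 1 +ₖ (-ₖ (r 1 *ₖ t 1))
          ≡⟨ cong₂ (λ a b → 0ₖ *ₖ b +ₖ b +ₖ a +ₖ (-ₖ (a *ₖ b)))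
               (root-coeff₁ φ₊ root-r) (root-coeff₁ φ₋ root-t) ⟩
        1ₖ ∎
        where
          r₀≡0 : r 0 ≡ 0ₖ
          r₀≡0 = root-coeff₀ φ₊ root-r
          t₀≡0 : t 0 ≡ 0ₖ
          t₀≡0 = root-coeff₀ φ₋ root-t

  W₀≡√5 : W 0 ≡ √5ₖ
  W₀≡√5 = begin
    W 0
      ≡⟨ cong₂ (λ a b → a +ₖ (-ₖ b)) (const-*ₚ φ₊ (const 1ₖ +ₚ t) 0) (const-*ₚ φ₋ (const 1ₖ +ₚ r) 0) ⟩
    φ₊ *ₖ (1ₖ +ₖ t 0) +ₖ (-ₖ (φ₋ *ₖ (1ₖ +ₖ r 0)))
      ≡⟨ cong₂ (λ a b → φ₊ *ₖ (1ₖ +ₖ a) +ₖ (-ₖ (φ₋ *ₖ (1ₖ +ₖ b))))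
           (root-coeff₀ φ₋ root-t) (root-coeff₀ φ₊ root-r) ⟩
    √5ₖ ∎
    where open ≡-Reasoning

  countJ-generating-function :
    (ofSeq (countJ 0) -ₚ const 1ₖ) *ₚ (X *ₚ r *ₚ t +ₚ X *ₚ t +ₚ X *ₚ r -ₚ r *ₚ t)
      ≋ X *ₚ r *ₚ t *ₚ (const 1ₖ +ₚ r *ₚ t)
  -- The witness √5/5 inverts the constant coefficient φ₊ - φ₋ = √5 of W.
  countJ-generating-function = unit-coeff₀⇒cancelˡ {W} (0ℚ ⊕ (+ 1 ℚ./ 5) √5)
    (cong ((0ℚ ⊕ (+ 1 ℚ./ 5) √5) *ₖ_) W₀≡√5)
    (generating-function {CJ 0} (λ n → W*CJ≋J n 0))

IsRoot⇒IsQuadraticRoot₊ : ∀ {s r} → IsSqrt √5ₖ s → IsRoot √5ₖ s r → IsQuadraticRoot φ₊ r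
IsRoot⇒IsQuadraticRoot₊ {s} {r} (_ , s²) root = X-cancel (x*quadratic₊ X s r s² root)

IsRoot⇒IsQuadraticRoot₋ : ∀ {s r} → IsSqrt (-ₖ √5ₖ) s → IsRoot (-ₖ √5ₖ) s r → IsQuadraticRoot φ₋ r
IsRoot⇒IsQuadraticRoot₋ {s} {r} (_ , s²) root = X-cancel (x*quadratic₋ X s r s² root)

quadraticRoot≢0 : ∀ c {r} → IsQuadraticRoot c r → NonZeroPS r
quadraticRoot≢0 c root = 1 , λ r₁≡0 → 1ₖ≢0ₖ (trans (sym (root-coeff₁ c root)) r₁≡0)

-- Cardinalities

open import Data.Nat using (_+_)
open import Data.Nat.Properties

-- Duplicate-free lists with the same members are rearrangements of each other. This identifies an
-- arbitrary sequence of cardinalities with the counts from the tree.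
HasCard-unique : ∀ {P a b} → HasCard P a → HasCard P b → a ≡ b
HasCard-unique (L , L! , refl , L⇔) (M , M! , refl , M⇔) =
  ↭-length (∼bag⇒↭ (unique∧set⇒bag L! M! (λ {σ} →
    mk⇔ (λ p → from (M⇔ σ) (to (L⇔ σ) p)) (λ p → from (L⇔ σ) (to (M⇔ σ) p)))))

HasCard-resp-⇔ : ∀ {P Q : List ℕ → Set} {c} → (∀ σ → P σ ⇔ Q σ) → HasCard P c → HasCard Q c
HasCard-resp-⇔ P⇔Q (L , L! , len , L⇔) =
  L , L! , len , λ σ → mk⇔ (λ p → to (P⇔Q σ) (to (L⇔ σ) p)) (λ q → from (L⇔ σ) (from (P⇔Q σ) q))

HasCard-∅ : ∀ {P : List ℕ → Set} → (∀ σ → ¬ P σ) → HasCard P 0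
HasCard-∅ ¬P = [] , [] , refl , λ σ → mk⇔ (λ ()) (λ p → ⊥-elim (¬P σ p))

HasCard-singleton : ∀ ρ → HasCard (_≡ ρ) 1
HasCard-singleton ρ = (ρ ∷ []) , [] ∷ [] , refl , λ σ → mk⇔ (λ { (here eq) → eq ; (there ()) }) here

HasCard-⊎ : ∀ {P Q : List ℕ → Set} {a b} → (∀ σ → P σ → Q σ → ⊥) →
  HasCard P a → HasCard Q b → HasCard (λ σ → P σ ⊎ Q σ) (a + b)
HasCard-⊎ disjoint (L , L! , refl , L⇔) (M , M! , refl , M⇔) =
  L ++ M ,
  Unique.++⁺ L! M! (λ {σ} (p , q) → disjoint σ (to (L⇔ σ) p) (to (M⇔ σ) q)) ,
  length-++ L ,
  λ σ → mk⇔ (λ p → split σ (∈-++⁻ L p))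
            (λ { (inj₁ p) → ∈-++⁺ˡ (from (L⇔ σ) p) ; (inj₂ q) → ∈-++⁺ʳ L (from (M⇔ σ) q) })
  where
    split : ∀ σ → σ ∈ L ⊎ σ ∈ M → _
    split σ (inj₁ p) = inj₁ (to (L⇔ σ) p)
    split σ (inj₂ q) = inj₂ (to (M⇔ σ) q)

HasCard-∃< : ∀ m (P : ℕ → List ℕ → Set) (c : ℕ → ℕ) → (∀ {i j σ} → P i σ → P j σ → i ≡ j) →
  (∀ i → i < m → HasCard (P i) (c i)) → HasCard (λ σ → ∃[ i ] (i < m × P i σ)) (sumℕ m c)
HasCard-∃< zero    P c disjoint h = HasCard-∅ λ { σ (i , () , _) }
HasCard-∃< (suc m) P c disjoint h = HasCard-resp-⇔
  (λ σ → mk⇔ (λ { (inj₁ p) → 0 , s≤s z≤n , p ; (inj₂ (i , i<m , p)) → suc i , s≤s i<m , p })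
             (λ { (zero , _ , p) → inj₁ p ; (suc i , s≤s i<m , p) → inj₂ (i , i<m , p) }))
  (HasCard-⊎ (λ { σ p (i , _ , q) → 0≢suc (disjoint p q) })
    (h 0 (s≤s z≤n))
    (HasCard-∃< m (λ i → P (suc i)) (λ i → c (suc i)) (λ p q → suc-injective (disjoint p q))
      (λ i i<m → h (suc i) (s≤s i<m))))
  where
    0≢suc : ∀ {i} → 0 ≡ suc i → ⊥
    0≢suc ()

HasCard-reverse : ∀ {P c} → HasCard P c → HasCard (λ σ → P (reverse σ)) c
HasCard-reverse {P} (L , L! , len , L⇔) =
  map reverse L , Unique.map⁺ reverse-injective L! , trans (length-map reverse L) len , λ σ → mk⇔
    (λ p → let ρ , ρ∈L , eq = ∈-map⁻ reverse p in
           subst P (sym (trans (cong reverse eq) (reverse-involutive ρ))) (to (L⇔ ρ) ρ∈L))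
    (λ p → subst (_∈ map reverse L) (reverse-involutive σ) (∈-map⁺ reverse (from (L⇔ (reverse σ)) p)))

-- Appending a value

-- The increasing coface map that skips v: it makes room for a new entry v.
bump : ℕ → ℕ → ℕ
bump zero    x       = suc x
bump (suc v) zero    = zero
bump (suc v) (suc x) = suc (bump v x)

-- The value at v itself is only a default, hence the hypothesis of `bump-unbump`.
unbump : ℕ → ℕ → ℕ
unbump v       zero    = zero
unbump zero    (suc x) = x
unbump (suc v) (suc x) = suc (unbump v x)

bump-below : ∀ {v x} → x < v → bump v x ≡ x
bump-below {suc v} {zero}  _         = refl
bump-below {suc v} {suc x} (s≤s x<v) = cong suc (bump-below x<v)

bump-above : ∀ {v x} → v ≤ x → bump v x ≡ suc x
bump-above {zero}          _         = refl
bump-above {suc v} {suc x} (s≤s v≤x) = cong suc (bump-above v≤x)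

bump≢ : ∀ v x → v ≢ bump v x
bump≢ (suc v) (suc x) eq = bump≢ v x (suc-injective eq)

bump≤suc : ∀ v x → bump v x ≤ suc x
bump≤suc zero    x       = ≤-refl
bump≤suc (suc v) zero    = z≤n
bump≤suc (suc v) (suc x) = s≤s (bump≤suc v x)

≤bump : ∀ v x → x ≤ bump v x
≤bump zero    x       = n≤1+n x
≤bump (suc v) zero    = z≤n
≤bump (suc v) (suc x) = s≤s (≤bump v x)

bump-mono-< : ∀ v {x y} → x < y → bump v x < bump v y
bump-mono-< zero    x<y               = s≤s x<y
bump-mono-< (suc v) {zero}  {suc y} _ = s≤s z≤n
bump-mono-< (suc v) {suc x} (s≤s x<y) = s≤s (bump-mono-< v x<y)

bump-cancel-< : ∀ v {x y} → bump v x < bump v y → x < y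
bump-cancel-< zero    (s≤s x<y)                   = x<y
bump-cancel-< (suc v) {zero}  {suc y} _           = s≤s z≤n
bump-cancel-< (suc v) {suc x} {suc y} (s≤s bx<by) = s≤s (bump-cancel-< v bx<by)

bump-injective : ∀ v {x y} → bump v x ≡ bump v y → x ≡ y
bump-injective zero                    eq = suc-injective eq
bump-injective (suc v) {zero}  {zero}  eq = refl
bump-injective (suc v) {suc x} {suc y} eq = cong suc (bump-injective v (suc-injective eq))

-- An old entry equal to v moves above the new one, so comparisons of v with shifted entries become
-- weak on one side and stay strict on the other.
<bump⇒≤ : ∀ v x → v < bump v x → v ≤ x
<bump⇒≤ v x v<bx = ≤-pred (≤-trans v<bx (bump≤suc v x))

≤⇒<bump : ∀ {v x} → v ≤ x → v < bump v x
≤⇒<bump v≤x = ≤-trans (s≤s v≤x) (≤-reflexive (sym (bump-above v≤x)))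

bump<⇒< : ∀ v x → bump v x < v → x < v
bump<⇒< v x bx<v = ≤-trans (s≤s (≤bump v x)) bx<v

<⇒bump< : ∀ {v x} → x < v → bump v x < v
<⇒bump< x<v = ≤-trans (s≤s (≤-reflexive (bump-below x<v))) x<v

bump-unbump : ∀ v x → v ≢ x → bump v (unbump v x) ≡ x
bump-unbump zero    zero    v≢x = ⊥-elim (v≢x refl)
bump-unbump (suc v) zero    v≢x = refl
bump-unbump zero    (suc x) v≢x = refl
bump-unbump (suc v) (suc x) v≢x = cong suc (bump-unbump v x (λ eq → v≢x (cong suc eq)))

-- Permutations are stored reversed, so that appending a value is a cons.
ext : ℕ → List ℕ → List ℕ
ext v ρ = v ∷ map (bump v) ρ

ext-injectiveˡ : ∀ {v w ρ π} → ext v ρ ≡ ext w π → v ≡ w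
ext-injectiveˡ = ∷-injectiveˡ

ext-injectiveʳ : ∀ {v ρ π} → ext v ρ ≡ ext v π → ρ ≡ π
ext-injectiveʳ {v} eq = map-injective (bump-injective v) (∷-injectiveʳ eq)

⊆-map⁻ : ∀ {A B : Set} (f : A → B) {ys} xs → ys ⊆ map f xs → ∃[ zs ] (zs ⊆ xs × ys ≡ map f zs)
⊆-map⁻ f []       []          = [] , [] , refl
⊆-map⁻ f (x ∷ xs) (_ ∷ʳ τ)    = let zs , zs⊆xs , eq = ⊆-map⁻ f xs τ in zs , x ∷ʳ zs⊆xs , eq
⊆-map⁻ f (x ∷ xs) (refl ∷ τ)  with zs , zs⊆xs , refl ← ⊆-map⁻ f xs τ = x ∷ zs , refl ∷ zs⊆xs , refl

-- Bad entries and forbidden patterns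

Bad : List ℕ → ℕ → Set
Bad ρ b = ∃[ c ] ∃[ d ] (d ∷ c ∷ b ∷ [] ⊆ ρ × b < c × (d < b ⊎ c < d))

-- Read backwards, this is b c d e with e < b < c and d outside the interval from b to c. If d < b
-- it is 3412 or 3421, depending on the order of d and e; if c < d it is 2341.
Forbidden : List ℕ → Set
Forbidden ρ = ∃[ b ] ∃[ c ] ∃[ d ] ∃[ e ] (e ∷ d ∷ c ∷ b ∷ [] ⊆ ρ × b < c × (d < b ⊎ c < d) × e < b)

bump-bad : ∀ v {b c d} → d < b ⊎ c < d → bump v d < bump v b ⊎ bump v c < bump v d
bump-bad v (inj₁ d<b) = inj₁ (bump-mono-< v d<b)
bump-bad v (inj₂ c<d) = inj₂ (bump-mono-< v c<d)

bump-bad⁻ : ∀ v {b c d} → bump v d < bump v b ⊎ bump v c < bump v d → d < b ⊎ c < d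
bump-bad⁻ v (inj₁ d<b) = inj₁ (bump-cancel-< v d<b)
bump-bad⁻ v (inj₂ c<d) = inj₂ (bump-cancel-< v c<d)

-- An appended value can only play the last letter e, so a new pattern comes from an old bad entry.
ext-forbidden⁻ : ∀ {v ρ} → Forbidden (ext v ρ) → Forbidden ρ ⊎ ∃[ b ] (Bad ρ b × v ≤ b)
ext-forbidden⁻ {v} {ρ} (_ , _ , _ , _ , refl ∷ τ , b<c , h , v<b) with ⊆-map⁻ (bump v) ρ τ
... | d ∷ c ∷ b ∷ [] , τ′ , refl =
  inj₂ (b , (c , d , τ′ , bump-cancel-< v b<c , bump-bad⁻ v h) , <bump⇒≤ v b v<b)
ext-forbidden⁻ {v} {ρ} (_ , _ , _ , _ , _ ∷ʳ τ , b<c , h , e<b) with ⊆-map⁻ (bump v) ρ τ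
... | e ∷ d ∷ c ∷ b ∷ [] , τ′ , refl =
  inj₁ (b , c , d , e , τ′ , bump-cancel-< v b<c , bump-bad⁻ v h , bump-cancel-< v e<b)

ext-forbidden : ∀ {v ρ} → Forbidden ρ → Forbidden (ext v ρ)
ext-forbidden {v} (b , c , d , e , τ , b<c , h , e<b) =
  _ , _ , _ , _ , v ∷ʳ Sublist.map⁺ (bump v) τ , bump-mono-< v b<c , bump-bad v h , bump-mono-< v e<b

ext-forbidden-bad : ∀ {v ρ b} → Bad ρ b → v ≤ b → Forbidden (ext v ρ)
ext-forbidden-bad {v} (c , d , τ , b<c , h) v≤b =
  _ , _ , _ , _ , refl ∷ Sublist.map⁺ (bump v) τ , bump-mono-< v b<c , bump-bad v h , ≤⇒<bump v≤b

-- The appended value can only play d, so new bad entries come from ascent pairs of the old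
-- permutation.
ext-bad⁻ : ∀ {v ρ b′} → Bad (ext v ρ) b′ →
  ∃[ b ] (b′ ≡ bump v b × (Bad ρ b ⊎ ∃[ c ] (c ∷ b ∷ [] ⊆ ρ × b < c × (v ≤ b ⊎ c < v))))
ext-bad⁻ {v} {ρ} (_ , _ , refl ∷ τ , b<c , h) with ⊆-map⁻ (bump v) ρ τ
... | c ∷ b ∷ [] , τ′ , refl = b , refl , inj₂ (c , τ′ , bump-cancel-< v b<c , side h)
  where
    side : v < bump v b ⊎ bump v c < v → v ≤ b ⊎ c < v
    side (inj₁ v<b) = inj₁ (<bump⇒≤ v b v<b)
    side (inj₂ c<v) = inj₂ (bump<⇒< v c c<v)
ext-bad⁻ {v} {ρ} (_ , _ , _ ∷ʳ τ , b<c , h) with ⊆-map⁻ (bump v) ρ τ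
... | d ∷ c ∷ b ∷ [] , τ′ , refl = b , refl , inj₁ (c , d , τ′ , bump-cancel-< v b<c , bump-bad⁻ v h)

ext-bad : ∀ {v ρ b} → Bad ρ b → Bad (ext v ρ) (bump v b)
ext-bad {v} (c , d , τ , b<c , h) = _ , _ , v ∷ʳ Sublist.map⁺ (bump v) τ , bump-mono-< v b<c , bump-bad v h

ext-bad-new : ∀ {v ρ b c} → c ∷ b ∷ [] ⊆ ρ → b < c → v ≤ b ⊎ c < v → Bad (ext v ρ) (bump v b)
ext-bad-new {v} {ρ} {b} {c} τ b<c h = _ , _ , refl ∷ Sublist.map⁺ (bump v) τ , bump-mono-< v b<c , side h
  where
    side : v ≤ b ⊎ c < v → v < bump v b ⊎ bump v c < v
    side (inj₁ v≤b) = inj₁ (≤⇒<bump v≤b)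
    side (inj₂ c<v) = inj₂ (<⇒bump< c<v)

-- Stated through membership, since this passes through appending and removing a value without
-- rearranging lists.
record Perm (n : ℕ) (ρ : List ℕ) : Set where
  field
    unique : Unique ρ
    lower  : ∀ {x} → x ∈ ρ → 1 ≤ x
    upper  : ∀ {x} → x ∈ ρ → x ≤ n
    full   : ∀ {x} → 1 ≤ x → x ≤ n → x ∈ ρ
open Perm

Perm-[] : Perm 0 []
Perm-[] = record { unique = [] ; lower = λ () ; upper = λ () ; full = λ { (s≤s _) () } }

ext-perm : ∀ {n v ρ} → 1 ≤ v → v ≤ suc n → Perm n ρ → Perm (suc n) (ext v ρ)
ext-perm {n} {v} {ρ} 1≤v v≤1+n perm = record
  { unique = All.tabulate fresh ∷ Unique.map⁺ (bump-injective v) (unique perm)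
  ; lower  = lower′
  ; upper  = upper′
  ; full   = full′
  }
  where
    fresh : ∀ {x} → x ∈ map (bump v) ρ → v ≢ x
    fresh p with y , _ , refl ← ∈-map⁻ (bump v) p = bump≢ v y
    lower′ : ∀ {x} → x ∈ ext v ρ → 1 ≤ x
    lower′ (here refl) = 1≤v
    lower′ (there p) with y , y∈ρ , refl ← ∈-map⁻ (bump v) p = ≤-trans (lower perm y∈ρ) (≤bump v y)
    upper′ : ∀ {x} → x ∈ ext v ρ → x ≤ suc n
    upper′ (here refl) = v≤1+n
    upper′ (there p) with y , y∈ρ , refl ← ∈-map⁻ (bump v) p = ≤-trans (bump≤suc v y) (s≤s (upper perm y∈ρ))
    bumped : ∀ {x y} → bump v y ≡ x → 1 ≤ y → y ≤ n → x ∈ ext v ρ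
    bumped refl 1≤y y≤n = there (∈-map⁺ (bump v) (full perm 1≤y y≤n))
    full′ : ∀ {x} → 1 ≤ x → x ≤ suc n → x ∈ ext v ρ
    full′ {x} 1≤x x≤1+n with <-cmp x v
    ... | tri< x<v _ _ = bumped (bump-below x<v) 1≤x (≤-pred (≤-trans x<v v≤1+n))
    ... | tri≈ _ refl _ = here refl
    full′ {suc x} 1≤x (s≤s x≤n) | tri> _ _ (s≤s v≤x) = bumped (bump-above v≤x) (≤-trans 1≤v v≤x) x≤n

ext-perm⁻ : ∀ {n v ρ} → Perm (suc n) (ext v ρ) → Perm n ρ
ext-perm⁻ {n} {v} {ρ} perm with unique perm
... | _ ∷ ρ! = record
  { unique = Unique.map⁻ ρ!
  ; lower  = lower′
  ; upper  = upper′
  ; full   = full′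
  }
  where
    1≤v : 1 ≤ v
    1≤v = lower perm (here refl)
    v≤1+n : v ≤ suc n
    v≤1+n = upper perm (here refl)
    bump∈ : ∀ {x} → x ∈ ρ → bump v x ∈ ext v ρ
    bump∈ p = there (∈-map⁺ (bump v) p)
    lower′ : ∀ {x} → x ∈ ρ → 1 ≤ x
    -- As v is positive, `bump v` fixes 0, so an entry 0 would survive in the extension.
    lower′ {zero}  p with () ← ≤-trans (lower perm (bump∈ p)) (≤-reflexive (bump-below {v} 1≤v))
    lower′ {suc x} p = s≤s z≤n
    upper′ : ∀ {x} → x ∈ ρ → x ≤ n
    upper′ {x} p with <-cmp x v
    ... | tri< x<v _ _ = ≤-pred (≤-trans x<v v≤1+n)
    ... | tri≈ _ refl _ = ≤-pred (≤-trans (≤⇒<bump ≤-refl) (upper perm (bump∈ p)))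
    ... | tri> _ _ v<x = ≤-pred (≤-trans (≤-reflexive (sym (bump-above (<⇒≤ v<x)))) (upper perm (bump∈ p)))
    full′ : ∀ {x} → 1 ≤ x → x ≤ n → x ∈ ρ
    full′ {x} 1≤x x≤n with full perm (≤-trans 1≤x (≤bump v x)) (≤-trans (bump≤suc v x) (s≤s x≤n))
    ... | here eq = ⊥-elim (bump≢ v x (sym eq))
    ... | there p with y , y∈ρ , eq ← ∈-map⁻ (bump v) p = subst (_∈ ρ) (sym (bump-injective v eq)) y∈ρ

perm-ext : ∀ {n σ} → Perm (suc n) σ → ∃[ v ] ∃[ ρ ] σ ≡ ext v ρ
perm-ext {σ = []} perm with () ← full perm {1} (s≤s z≤n) (s≤s z≤n)
perm-ext {σ = v ∷ π} perm with unique perm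
... | v∉π ∷ _ = v , map (unbump v) π , cong (v ∷_) (sym (trans (sym (map-∘ π))
  (map-id-local (All.map (λ {x} v≢x → bump-unbump v x v≢x) v∉π))))

-- The states J and H and their children

-- Entries are positive, so B = 0 can stand for the absence of bad entries.
record Node (n B : ℕ) (ρ : List ℕ) : Set where
  field
    perm    : Perm n ρ
    avoids  : ¬ Forbidden ρ
    bad≤    : ∀ {b} → Bad ρ b → b ≤ B
    bad-max : B ≡ 0 ⊎ Bad ρ B
open Node

-- A value v ≤ B would complete the pattern that starts at the bad entry B.
active⇒> : ∀ {n B ρ v} → Node n B ρ → 1 ≤ v → ¬ Forbidden (ext v ρ) → B < v
active⇒> {B = B} {v = v} node 1≤v ¬forb with <-cmp B v | bad-max node
... | tri< B<v _ _ | _          = B<v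
... | tri≈ _ B≡v _ | inj₁ B≡0   = ⊥-elim (<⇒≢ 1≤v (trans (sym B≡0) B≡v))
... | tri≈ _ B≡v _ | inj₂ bad   = ⊥-elim (¬forb (ext-forbidden-bad bad (≤-reflexive (sym B≡v))))
... | tri> _ _ v<B | inj₁ refl  = ⊥-elim (n≮0 v<B)
... | tri> _ _ v<B | inj₂ bad   = ⊥-elim (¬forb (ext-forbidden-bad bad (<⇒≤ v<B)))

bad-max-ext : ∀ {n B ρ v} → Node n B ρ → B < v → B ≡ 0 ⊎ Bad (ext v ρ) B
bad-max-ext {B = B} {ρ} {v} node B<v with bad-max node
... | inj₁ B≡0 = inj₁ B≡0
... | inj₂ bad = inj₂ (subst (Bad (ext v ρ)) (bump-below B<v) (ext-bad bad))

-- Conversely every v > B is allowed. Old bad entries lie below v and keep their values, so only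
-- those created from ascent pairs must be checked against B′.
child : ∀ {n B B′ ρ v} → Node n B ρ → B < v → v ≤ suc n → B ≤ B′ →
  (∀ {b c} → c ∷ b ∷ [] ⊆ ρ → b < c → v ≤ b ⊎ c < v → bump v b ≤ B′) →
  B′ ≡ 0 ⊎ Bad (ext v ρ) B′ → Node (suc n) B′ (ext v ρ)
child {B = B} {B′} {ρ} {v} node B<v v≤1+n B≤B′ new bad-max′ = record
  { perm    = ext-perm (≤-trans (s≤s z≤n) B<v) v≤1+n (perm node)
  ; avoids  = λ forb → [ avoids node , (λ (b , bad , v≤b) → <⇒≱ B<v (≤-trans v≤b (bad≤ node bad))) ]′
                         (ext-forbidden⁻ forb)
  ; bad≤    = λ bad → bound (ext-bad⁻ bad)
  ; bad-max = bad-max′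
  }
  where
    bound : ∀ {b′} →
      ∃[ b ] (b′ ≡ bump v b × (Bad ρ b ⊎ ∃[ c ] (c ∷ b ∷ [] ⊆ ρ × b < c × (v ≤ b ⊎ c < v)))) → b′ ≤ B′
    bound (b , refl , inj₁ bad) = ≤-trans
      (≤-reflexive (bump-below (≤-<-trans (bad≤ node bad) B<v))) (≤-trans (bad≤ node bad) B≤B′)
    bound (b , refl , inj₂ (c , τ , b<c , h)) = new τ b<c h

record StateJ (n B q : ℕ) (ρ : List ℕ) : Set where
  field
    node : Node n B ρ
    size : n ≡ B + q
    ascent≤ : ∀ {b c} → c ∷ b ∷ [] ⊆ ρ → b < c → b ≤ B

record StateH (n B p q : ℕ) (ρ : List ℕ) : Set where
  field
    node : Node n B ρ
    size : n ≡ suc (B + p) + q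
    rest : List ℕ
    head : ρ ≡ suc (B + p) ∷ rest

StateJ-[] : StateJ 0 0 0 []
StateJ-[] = record
  { node = record { perm = Perm-[] ; avoids = λ () ; bad≤ = λ () ; bad-max = inj₁ refl }
  ; size = refl
  ; ascent≤ = λ ()
  }

-- Ascent pairs start at or below B, so whatever becomes bad is at most B, and B does not change.
StateJ-child : ∀ {n B q ρ i} → StateJ n B q ρ → i < suc q → StateH (suc n) B i (q ∸ i) (ext (suc (B + i)) ρ)
StateJ-child {n} {B} {q} {ρ} {i} state (s≤s i≤q) = record
  { node = child (StateJ.node state) B<v v≤1+n ≤-refl new (bad-max-ext (StateJ.node state) B<v)
  ; size = cong suc n≡
  ; rest = _
  ; head = refl
  }
  where
    B<v : B < suc (B + i)
    B<v = s≤s (m≤m+n B i)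
    n≡ : n ≡ B + i + (q ∸ i)
    n≡ = trans (StateJ.size state)
      (trans (cong (λ z → B + z) (sym (m+[n∸m]≡n i≤q))) (sym (+-assoc B i (q ∸ i))))
    v≤1+n : suc (B + i) ≤ suc n
    v≤1+n = s≤s (≤-trans (m≤m+n (B + i) (q ∸ i)) (≤-reflexive (sym n≡)))
    new : ∀ {b c} → c ∷ b ∷ [] ⊆ ρ → b < c → suc (B + i) ≤ b ⊎ c < suc (B + i) → bump (suc (B + i)) b ≤ B
    new τ b<c _ = ≤-trans
      (≤-reflexive (bump-below (≤-<-trans (StateJ.ascent≤ state τ b<c) B<v))) (StateJ.ascent≤ state τ b<c)

module HState {n B p q : ℕ} {ρ′ : List ℕ} (node : Node n B (suc (B + p) ∷ ρ′)) (size : n ≡ suc (B + p) + q) where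

  ℓ : ℕ
  ℓ = suc (B + p)

  ρ : List ℕ
  ρ = ℓ ∷ ρ′

  B<ℓ : B < ℓ
  B<ℓ = s≤s (m≤m+n B p)

  ℓ≤n : ℓ ≤ n
  ℓ≤n = ≤-trans (m≤m+n ℓ q) (≤-reflexive (sym size))

  -- If ℓ < b, the last entry ℓ completes b c to a pattern making b bad, although b > ℓ > B.
  ascent⇒<ℓ : ∀ {b c} → c ∷ b ∷ [] ⊆ ρ → b < c → b < ℓ
  ascent⇒<ℓ (refl ∷ _) b<c = b<c
  ascent⇒<ℓ {b} {c} (_ ∷ʳ τ) b<c with <-cmp b ℓ
  ... | tri< b<ℓ _ _ = b<ℓ
  ... | tri≈ _ refl _ with ℓ∉ρ′ ∷ _ ← unique (perm node) = ⊥-elim (All.lookup ℓ∉ρ′ (to∈ (Sublist.∷ˡ⁻ τ)) refl)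
  ... | tri> _ _ ℓ<b = ⊥-elim (<⇒≱ (<-trans B<ℓ ℓ<b) (bad≤ node (c , ℓ , refl ∷ τ , b<c , inj₁ ℓ<b)))

  small-ascent⇒≤B : ∀ {b c} → c ∷ b ∷ [] ⊆ ρ → b < c → c < ℓ → b ≤ B
  small-ascent⇒≤B (refl ∷ _) b<c c<ℓ = ⊥-elim (<-irrefl refl c<ℓ)
  small-ascent⇒≤B {c = c} (_ ∷ʳ τ) b<c c<ℓ = bad≤ node (c , ℓ , refl ∷ τ , b<c , inj₂ c<ℓ)

  -- For p > 0 the pair (ℓ - 1, ℓ) is an ascent pair with the largest first entry that `ascent⇒<ℓ`
  -- permits; it determines the next B.
  below-ℓ : 0 < p → ℓ ∷ (B + p) ∷ [] ⊆ ρ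
  below-ℓ 0<p with full (perm node) (≤-trans 0<p (m≤n+m p B)) (≤-trans (n≤1+n (B + p)) ℓ≤n)
  ... | here eq = ⊥-elim (1+n≢n (sym eq))
  ... | there i = refl ∷ from∈ i

  -- A value at most ℓ - 1 makes ℓ - 1 bad and shifts it to ℓ. Every ascent pair then starts at or
  -- below ℓ, which gives a state J.
  childJ : ∀ {j} → j < p → StateJ (suc n) ℓ (suc q) (ext (suc (B + j)) ρ)
  childJ {j} j<p = record
    { node = child node (s≤s (m≤m+n B j))
               (s≤s (≤-trans (<⇒≤ (+-monoʳ-< B j<p)) (≤-trans (n≤1+n (B + p)) ℓ≤n)))
               (<⇒≤ B<ℓ) (λ τ b<c _ → bumped τ b<c)
               (inj₂ (subst (Bad _) (bump-above v≤B+p)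
                 (ext-bad-new (below-ℓ (≤-trans (s≤s z≤n) j<p)) ≤-refl (inj₁ v≤B+p))))
    ; size = trans (cong suc size) (sym (+-suc ℓ q))
    ; ascent≤ = ascent≤
    }
    where
      v : ℕ
      v = suc (B + j)
      v≤B+p : v ≤ B + p
      v≤B+p = +-monoʳ-< B j<p
      bumped : ∀ {b c} → c ∷ b ∷ [] ⊆ ρ → b < c → bump v b ≤ ℓ
      bumped {b} τ b<c = ≤-trans (bump≤suc v b) (ascent⇒<ℓ τ b<c)
      ascent≤ : ∀ {b c} → c ∷ b ∷ [] ⊆ ext v ρ → b < c → b ≤ ℓ
      ascent≤ (refl ∷ _) b<v = <⇒≤ (<-≤-trans b<v (≤-trans v≤B+p (n≤1+n (B + p))))
      ascent≤ (_ ∷ʳ τ) b<c with ⊆-map⁻ (bump v) ρ τ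
      ... | c ∷ b ∷ [] , τ′ , refl = bumped τ′ (bump-cancel-< v b<c)

  -- Appending ℓ spoils only ascent pairs with c < ℓ, whose first entry is bad already, so B stays.
  child-ℓ : StateH (suc n) B p (suc q) (ext ℓ ρ)
  child-ℓ = record
    { node = child node B<ℓ (≤-trans ℓ≤n (n≤1+n n)) ≤-refl new (bad-max-ext node B<ℓ)
    ; size = trans (cong suc size) (sym (+-suc ℓ q))
    ; rest = _
    ; head = refl
    }
    where
      new : ∀ {b c} → c ∷ b ∷ [] ⊆ ρ → b < c → ℓ ≤ b ⊎ c < ℓ → bump ℓ b ≤ B
      new τ b<c (inj₁ ℓ≤b) = ⊥-elim (<⇒≱ (ascent⇒<ℓ τ b<c) ℓ≤b)
      new τ b<c (inj₂ c<ℓ) = ≤-trans (≤-reflexive (bump-below (<-trans b<c c<ℓ))) (small-ascent⇒≤B τ b<c c<ℓ)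

  -- A value above ℓ makes the first entry of every ascent pair ending in ℓ bad. The largest is ℓ -
  -- 1 = B + p, the new bound.
  childH : ∀ {i} → i < suc q → StateH (suc n) (B + p) (suc i) (q ∸ i) (ext (suc (ℓ + i)) ρ)
  childH {i} (s≤s i≤q) = record
    { node = child node (<-trans B<ℓ ℓ<v) v≤1+n (m≤m+n B p) (λ τ b<c _ → new τ b<c) bad-max′
    ; size = cong suc (trans n≡ (cong (_+ (q ∸ i)) (sym (+-suc (B + p) i))))
    ; rest = _
    ; head = cong (λ z → suc z ∷ map (bump (suc (ℓ + i))) ρ) (sym (+-suc (B + p) i))
    }
    where
      v : ℕ
      v = suc (ℓ + i)
      ℓ<v : ℓ < v
      ℓ<v = s≤s (m≤m+n ℓ i)
      n≡ : n ≡ ℓ + i + (q ∸ i)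
      n≡ = trans size (trans (cong (λ z → ℓ + z) (sym (m+[n∸m]≡n i≤q))) (sym (+-assoc ℓ i (q ∸ i))))
      v≤1+n : v ≤ suc n
      v≤1+n = s≤s (≤-trans (m≤m+n (ℓ + i) (q ∸ i)) (≤-reflexive (sym n≡)))
      new : ∀ {b c} → c ∷ b ∷ [] ⊆ ρ → b < c → bump v b ≤ B + p
      new τ b<c = ≤-trans (≤-reflexive (bump-below (<-trans (ascent⇒<ℓ τ b<c) ℓ<v))) (≤-pred (ascent⇒<ℓ τ b<c))
      bad-max′ : B + p ≡ 0 ⊎ Bad (ext v ρ) (B + p)
      bad-max′ with m≤n⇒m<n∨m≡n {0} {p} z≤n
      ... | inj₁ 0<p = inj₂ (subst (Bad (ext v ρ)) (bump-below (<-trans ≤-refl ℓ<v))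
                               (ext-bad-new (below-ℓ 0<p) ≤-refl (inj₂ ℓ<v)))
      -- For p = 0 the new bound is B itself, attained by the old bad entry if there is one.
      ... | inj₂ 0≡p = subst (λ z → z ≡ 0 ⊎ Bad (ext v ρ) z)
                         (trans (sym (+-identityʳ B)) (cong (λ z → B + z) 0≡p))
                         (bad-max-ext node (<-trans B<ℓ ℓ<v))

-- Desc d n ρ σ: σ arises from ρ, a permutation of [n], by appending d values without creating a forbidden pattern.
Desc : ℕ → ℕ → List ℕ → List ℕ → Set
Desc zero    n ρ σ = σ ≡ ρ
Desc (suc d) n ρ σ = ∃[ v ] (1 ≤ v × v ≤ suc n × ¬ Forbidden (ext v ρ) × Desc d (suc n) (ext v ρ) σ)

-- Removing the last d values recovers the ancestor; hence subtrees of different children are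
-- disjoint.
Desc-functional : ∀ d {n ρ π σ} → Desc d n ρ σ → Desc d n π σ → ρ ≡ π
Desc-functional zero    eq eq′ = trans (sym eq) eq′
Desc-functional (suc d) (v , _ , _ , _ , desc) (w , _ , _ , _ , desc′) = ext-injective (Desc-functional d desc desc′)
  where
    ext-injective : ∀ {v w ρ π} → ext v ρ ≡ ext w π → ρ ≡ π
    ext-injective eq with refl ← ext-injectiveˡ eq = ext-injectiveʳ eq

Desc-ext-functional : ∀ d {n ρ v w σ} → Desc d n (ext v ρ) σ → Desc d n (ext w ρ) σ → v ≡ w
Desc-ext-functional d desc desc′ = ext-injectiveˡ (Desc-functional d desc desc′)

-- Induction on the depth: the allowed values, and with them the descendants, split according to the
-- states of the children.
hasCardJ : ∀ d {n B q ρ} → StateJ n B q ρ → HasCard (Desc d n ρ) (countJ q d)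
hasCardH : ∀ d {n B p q ρ} → StateH n B p q ρ → HasCard (Desc d n ρ) (countH p q d)
hasCardJ zero {ρ = ρ} state = HasCard-singleton ρ
hasCardJ (suc d) {n} {B} {q} {ρ} state = HasCard-resp-⇔ (λ σ → mk⇔ (join σ) (split σ))
  (HasCard-∃< (suc q) (λ i → Desc d (suc n) (ext (suc (B + i)) ρ)) (λ i → countH i (q ∸ i) d)
    (λ p p′ → +-cancelˡ-≡ B _ _ (suc-injective (Desc-ext-functional d p p′)))
    (λ i i<1+q → hasCardH d (StateJ-child state i<1+q)))
  where
    join : ∀ σ → ∃[ i ] (i < suc q × Desc d (suc n) (ext (suc (B + i)) ρ) σ) → Desc (suc d) n ρ σ
    join σ (i , i<1+q , desc) = suc (B + i) , s≤s z≤n , upper (perm node) (here refl) , avoids node , desc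
      where
        node : Node (suc n) B (ext (suc (B + i)) ρ)
        node = StateH.node (StateJ-child state i<1+q)
    split : ∀ σ → Desc (suc d) n ρ σ → ∃[ i ] (i < suc q × Desc d (suc n) (ext (suc (B + i)) ρ) σ)
    split σ (v , 1≤v , v≤1+n , ¬forb , desc)
      with i , refl ← m≤n⇒∃[o]m+o≡n (active⇒> (StateJ.node state) 1≤v ¬forb) =
      i , s≤s (+-cancelˡ-≤ B i q (≤-trans (≤-pred v≤1+n) (≤-reflexive (StateJ.size state)))) , desc
hasCardH zero {ρ = ρ} state = HasCard-singleton ρ
hasCardH (suc d) {n} {B} {p} {q} record { node = node ; size = size ; rest = ρ′ ; head = refl } =
  HasCard-resp-⇔ (λ σ → mk⇔ join split)
    (HasCard-⊎ (λ { σ (inj₁ (j , j<p , x)) (i , _ , y) →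
                      <⇒≢ (s≤s (≤-trans (+-monoʳ-< B j<p) (≤-trans (n≤1+n (B + p)) (m≤m+n ℓ i)))) (same x y)
                  ; σ (inj₂ x) (i , _ , y) → <⇒≢ (s≤s (m≤m+n ℓ i)) (same x y) })
      (HasCard-⊎ (λ { σ (j , j<p , x) y → <⇒≢ (s≤s (+-monoʳ-< B j<p)) (same x y) })
        (HasCard-∃< p (λ j → Desc d (suc n) (ext (suc (B + j)) ρ)) (λ _ → countJ (suc q) d)
          (λ x y → +-cancelˡ-≡ B _ _ (suc-injective (same x y)))
          (λ j j<p → hasCardJ d (childJ j<p)))
        (hasCardH d child-ℓ))
      (HasCard-∃< (suc q) (λ i → Desc d (suc n) (ext (suc (ℓ + i)) ρ)) (λ i → countH (suc i) (q ∸ i) d)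
        (λ x y → +-cancelˡ-≡ ℓ _ _ (suc-injective (same x y)))
        (λ i i<1+q → hasCardH d (childH i<1+q))))
  where
    open HState node size
    same : ∀ {v w σ} → Desc d (suc n) (ext v ρ) σ → Desc d (suc n) (ext w ρ) σ → v ≡ w
    same = Desc-ext-functional d {ρ = ρ}
    Below Above : List ℕ → Set
    Below σ = ∃[ j ] (j < p × Desc d (suc n) (ext (suc (B + j)) ρ) σ)
    Above σ = ∃[ i ] (i < suc q × Desc d (suc n) (ext (suc (ℓ + i)) ρ) σ)
    active : ∀ {B v σ} → Node (suc n) B (ext v ρ) → Desc d (suc n) (ext v ρ) σ → Desc (suc d) n ρ σ
    active {v = v} node′ desc =
      v , lower (perm node′) (here refl) , upper (perm node′) (here refl) , avoids node′ , desc
    join : ∀ {σ} → (Below σ ⊎ Desc d (suc n) (ext ℓ ρ) σ) ⊎ Above σ → Desc (suc d) n ρ σ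
    join (inj₁ (inj₁ (j , j<p , desc))) = active (StateJ.node (childJ j<p)) desc
    join (inj₁ (inj₂ desc))             = active (StateH.node child-ℓ) desc
    join (inj₂ (i , i<1+q , desc))      = active (StateH.node (childH i<1+q)) desc
    split : ∀ {σ} → Desc (suc d) n ρ σ → (Below σ ⊎ Desc d (suc n) (ext ℓ ρ) σ) ⊎ Above σ
    split (v , 1≤v , v≤1+n , ¬forb , desc) with <-cmp v ℓ
    ... | tri≈ _ refl _ = inj₁ (inj₂ desc)
    ... | tri> _ _ ℓ<v with i , refl ← m≤n⇒∃[o]m+o≡n ℓ<v =
      inj₂ (i , s≤s (+-cancelˡ-≤ ℓ i q (≤-trans (≤-pred v≤1+n) (≤-reflexive size))) , desc)
    split (v , 1≤v , v≤1+n , ¬forb , desc) | tri< v<ℓ _ _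
      with j , refl ← m≤n⇒∃[o]m+o≡n (active⇒> node 1≤v ¬forb) =
      inj₁ (inj₁ (j , +-cancelˡ-< B j p (≤-pred v<ℓ) , desc))

-- `Desc` unfolds from the root, whereas a given permutation reveals its last value first.
Desc-snoc : ∀ d {n ρ σ v} → Desc d n ρ σ → 1 ≤ v → v ≤ suc (d + n) → ¬ Forbidden (ext v σ) →
  Desc (suc d) n ρ (ext v σ)
Desc-snoc zero    refl 1≤v v≤ ¬forb = _ , 1≤v , v≤ , ¬forb , refl
Desc-snoc (suc d) {n} {v = v} (w , 1≤w , w≤ , ¬forb′ , desc) 1≤v v≤ ¬forb =
  w , 1≤w , w≤ , ¬forb′ , Desc-snoc d desc 1≤v (≤-trans v≤ (s≤s (≤-reflexive (sym (+-suc d n))))) ¬forb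

Desc⇒perm : ∀ d {n ρ σ} → Perm n ρ → ¬ Forbidden ρ → Desc d n ρ σ → Perm (d + n) σ × ¬ Forbidden σ
Desc⇒perm zero    perm ¬forb refl = perm , ¬forb
Desc⇒perm (suc d) {n} {σ = σ} perm ¬forb (v , 1≤v , v≤1+n , ¬forb′ , desc)
  with perm′ , ¬forb″ ← Desc⇒perm d (ext-perm 1≤v v≤1+n perm) ¬forb′ desc =
  subst (λ m → Perm m σ) (+-suc d n) perm′ , ¬forb″

perm⇒Desc : ∀ n {σ} → Perm n σ → ¬ Forbidden σ → Desc n 0 [] σ
perm⇒Desc zero {[]}    perm ¬forb = refl
perm⇒Desc zero {x ∷ σ} perm ¬forb = ⊥-elim (<⇒≱ (lower perm (here refl)) (upper perm (here refl)))
perm⇒Desc (suc n) perm ¬forb with v , ρ , refl ← perm-ext perm =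
  Desc-snoc n (perm⇒Desc n (ext-perm⁻ perm) (λ forb → ¬forb (ext-forbidden forb)))
    (lower perm (here refl)) (≤-trans (upper perm (here refl)) (s≤s (≤-reflexive (sym (+-identityʳ n))))) ¬forb

hasCard-perms : ∀ n → HasCard (λ ρ → Perm n ρ × ¬ Forbidden ρ) (countJ 0 n)
hasCard-perms n = HasCard-resp-⇔ (λ σ → mk⇔
    (λ desc → subst (λ m → Perm m σ × ¬ Forbidden σ) (+-identityʳ n)
      (Desc⇒perm n Perm-[] (λ { (_ , _ , _ , _ , () , _) }) desc))
    (λ (perm , ¬forb) → perm⇒Desc n perm ¬forb))
  (hasCardJ n StateJ-[])

-- Comparison with the definition of S_n(T)

unique-resp-↭ : ∀ {xs ys : List ℕ} → xs ↭ ys → Unique xs → Unique ys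
unique-resp-↭ xs↭ys = Permutationₛ.Unique-resp-↭ (≡-setoid ℕ) (↭⇒↭ₛ xs↭ys)

Perm-resp-↭ : ∀ {n xs ys} → xs ↭ ys → Perm n xs → Perm n ys
Perm-resp-↭ xs↭ys perm = record
  { unique = unique-resp-↭ xs↭ys (unique perm)
  ; lower  = λ p → lower perm (∈-resp-↭ (↭-sym xs↭ys) p)
  ; upper  = λ p → upper perm (∈-resp-↭ (↭-sym xs↭ys) p)
  ; full   = λ 1≤x x≤n → ∈-resp-↭ xs↭ys (full perm 1≤x x≤n)
  }

Perm-upTo : ∀ n → Perm n (map suc (upTo n))
Perm-upTo n = record
  { unique = Unique.map⁺ suc-injective (Unique.upTo⁺ n)
  ; lower  = lower′
  ; upper  = upper′
  ; full   = λ { (s≤s z≤n) x≤n → ∈-map⁺ suc (∈-upTo⁺ x≤n) }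
  }
  where
    lower′ : ∀ {x} → x ∈ map suc (upTo n) → 1 ≤ x
    lower′ p with _ , _ , refl ← ∈-map⁻ suc p = s≤s z≤n
    upper′ : ∀ {x} → x ∈ map suc (upTo n) → x ≤ n
    upper′ p with _ , q , refl ← ∈-map⁻ suc p = ∈-upTo⁻ q

Perm-unique : ∀ {n xs ys} → Perm n xs → Perm n ys → xs ↭ ys
Perm-unique p q = ∼bag⇒↭ (unique∧set⇒bag (unique p) (unique q)
  (mk⇔ (λ x∈xs → full q (lower p x∈xs) (upper p x∈xs)) (λ x∈ys → full p (lower q x∈ys) (upper q x∈ys))))

IsPerm⇒Perm-reverse : ∀ {n σ} → IsPerm n σ → Perm n (reverse σ)
IsPerm⇒Perm-reverse {n} {σ} σ↭ = Perm-resp-↭ (↭-trans (↭-sym σ↭) (↭-sym (↭-reverse σ))) (Perm-upTo n)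

Perm-reverse⇒IsPerm : ∀ {n σ} → Perm n (reverse σ) → IsPerm n σ
Perm-reverse⇒IsPerm {n} {σ} perm = ↭-trans (↭-sym (↭-reverse σ)) (Perm-unique perm (Perm-upTo n))

-- Order isomorphism with the three patterns

SameOrder : (x x′ y y′ : ℕ) → Set
SameOrder x x′ y y′ = (x < x′ × y < y′) ⊎ (x′ < x × y′ < y)

sameOrder⇒⇔ : ∀ {x x′ y y′} → SameOrder x x′ y y′ → (x < x′) ⇔ (y < y′)
sameOrder⇒⇔ (inj₁ (p , q)) = mk⇔ (λ _ → q) (λ _ → p)
sameOrder⇒⇔ (inj₂ (p , q)) = mk⇔ (λ p′ → ⊥-elim (<-asym p p′)) (λ q′ → ⊥-elim (<-asym q q′))

sameOrder-sym : ∀ {x x′ y y′} → SameOrder x x′ y y′ → SameOrder x′ x y′ y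
sameOrder-sym (inj₁ p) = inj₂ p
sameOrder-sym (inj₂ p) = inj₁ p

irrefl⇔ : ∀ {x y} → (x < x) ⇔ (y < y)
irrefl⇔ = mk⇔ (λ p → ⊥-elim (<-irrefl refl p)) (λ p → ⊥-elim (<-irrefl refl p))

orderIso₄ : ∀ {a b c d a′ b′ c′ d′} →
  SameOrder a b a′ b′ → SameOrder a c a′ c′ → SameOrder a d a′ d′ →
  SameOrder b c b′ c′ → SameOrder b d b′ d′ → SameOrder c d c′ d′ →
  OrderIso (a ∷ b ∷ c ∷ d ∷ []) (a′ ∷ b′ ∷ c′ ∷ d′ ∷ [])
orderIso₄ {a} {b} {c} {d} {a′} {b′} {c′} {d′} ab ac ad bc bd cd = refl , iso
  where
    iso : (i j : Fin 4) → _ ⇔ _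
    iso 0F 0F = irrefl⇔
    iso 0F 1F = sameOrder⇒⇔ ab
    iso 0F 2F = sameOrder⇒⇔ ac
    iso 0F 3F = sameOrder⇒⇔ ad
    iso 1F 0F = sameOrder⇒⇔ (sameOrder-sym ab)
    iso 1F 1F = irrefl⇔
    iso 1F 2F = sameOrder⇒⇔ bc
    iso 1F 3F = sameOrder⇒⇔ bd
    iso 2F 0F = sameOrder⇒⇔ (sameOrder-sym ac)
    iso 2F 1F = sameOrder⇒⇔ (sameOrder-sym bc)
    iso 2F 2F = irrefl⇔
    iso 2F 3F = sameOrder⇒⇔ cd
    iso 3F 0F = sameOrder⇒⇔ (sameOrder-sym ad)
    iso 3F 1F = sameOrder⇒⇔ (sameOrder-sym bd)
    iso 3F 2F = sameOrder⇒⇔ (sameOrder-sym cd)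
    iso 3F 3F = irrefl⇔

Unique⇒≢ : ∀ {x y : ℕ} {xs zs} → Unique zs → x ∷ y ∷ xs ⊆ zs → x ≢ y
Unique⇒≢ (_ ∷ zs!)  (_ ∷ʳ τ)   = Unique⇒≢ zs! τ
Unique⇒≢ (x∉zs ∷ _) (refl ∷ τ) = All.lookup x∉zs (to∈ τ)

Forbidden-reverse⇒contains : ∀ {σ} → Unique (reverse σ) → Forbidden (reverse σ) → ¬ AvoidsAll σ Tpat
Forbidden-reverse⇒contains {σ} σ! (b , c , d , e , τ , b<c , h , e<b) (¬3412 ∷ ¬3421 ∷ ¬2341 ∷ []) = contains h
  where
    bcde⊆σ : b ∷ c ∷ d ∷ e ∷ [] ⊆ σ
    bcde⊆σ = subst (_ ⊆_) (reverse-involutive σ) (reverse⁺ τ)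
    e≢d : e ≢ d
    e≢d = Unique⇒≢ σ! τ
    lt : ∀ {x y x′ y′} → x < x′ → y < y′ → SameOrder x x′ y y′
    lt p q = inj₁ (p , q)
    gt : ∀ {x y x′ y′} → x′ < x → y′ < y → SameOrder x x′ y y′
    gt p q = inj₂ (p , q)
    contains : d < b ⊎ c < d → ⊥
    contains (inj₂ c<d) = ¬2341 (_ , bcde⊆σ , orderIso₄
      (lt b<c ≤-refl) (lt (<-trans b<c c<d) (s≤s (s≤s (s≤s z≤n)))) (gt e<b ≤-refl)
      (lt c<d ≤-refl) (gt (<-trans e<b b<c) (s≤s (s≤s z≤n))) (gt (<-trans e<b (<-trans b<c c<d)) (s≤s (s≤s z≤n))))
    contains (inj₁ d<b) with <-cmp e d
    ... | tri≈ _ e≡d _ = e≢d e≡d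
    ... | tri< e<d _ _ = ¬3421 (_ , bcde⊆σ , orderIso₄
      (lt b<c ≤-refl) (gt d<b ≤-refl) (gt e<b (s≤s (s≤s z≤n)))
      (gt (<-trans d<b b<c) (s≤s (s≤s (s≤s z≤n)))) (gt (<-trans e<b b<c) (s≤s (s≤s z≤n))) (gt e<d ≤-refl))
    ... | tri> _ _ d<e = ¬3412 (_ , bcde⊆σ , orderIso₄
      (lt b<c ≤-refl) (gt d<b (s≤s (s≤s z≤n))) (gt e<b ≤-refl)
      (gt (<-trans d<b b<c) (s≤s (s≤s z≤n))) (gt (<-trans e<b b<c) (s≤s (s≤s (s≤s z≤n)))) (lt d<e ≤-refl))

-- Treats 3412 and 3421 together: only the fact that both final letters lie below the first one
-- matters.
contains⇒Forbidden-reverse : ∀ {σ s} {i j : ℕ} → s ⊆ σ → OrderIso s (3 ∷ 4 ∷ i ∷ j ∷ []) →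
  i < 3 → j < 3 → Forbidden (reverse σ)
contains⇒Forbidden-reverse {s = b ∷ c ∷ d ∷ e ∷ []} s⊆σ (_ , iso) i<3 j<3 =
  b , c , d , e , reverse⁺ s⊆σ , from (iso 0F 1F) ≤-refl
  , inj₁ (from (iso 2F 0F) i<3) , from (iso 3F 0F) j<3

contains-2341⇒Forbidden-reverse : ∀ {σ s} → s ⊆ σ → OrderIso s (2 ∷ 3 ∷ 4 ∷ 1 ∷ []) → Forbidden (reverse σ)
contains-2341⇒Forbidden-reverse {s = b ∷ c ∷ d ∷ e ∷ []} s⊆σ (_ , iso) =
  b , c , d , e , reverse⁺ s⊆σ , from (iso 0F 1F) ≤-refl
  , inj₂ (from (iso 1F 2F) ≤-refl) , from (iso 3F 0F) ≤-refl

InSnT⇔ : ∀ n σ → (Perm n (reverse σ) × ¬ Forbidden (reverse σ)) ⇔ InSnT Tpat n σ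
InSnT⇔ n σ = mk⇔
  (λ (perm , ¬forb) → Perm-reverse⇒IsPerm perm ,
    (λ (s , s⊆σ , iso) → ¬forb (contains⇒Forbidden-reverse s⊆σ iso (s≤s (s≤s z≤n)) ≤-refl)) ∷
    (λ (s , s⊆σ , iso) → ¬forb (contains⇒Forbidden-reverse s⊆σ iso ≤-refl (s≤s (s≤s z≤n)))) ∷
    (λ (s , s⊆σ , iso) → ¬forb (contains-2341⇒Forbidden-reverse s⊆σ iso)) ∷ [])
  (λ (isPerm , avoids) → IsPerm⇒Perm-reverse isPerm ,
    λ forb → Forbidden-reverse⇒contains (unique (IsPerm⇒Perm-reverse isPerm)) forb avoids)

hasCard-InSnT : ∀ n → HasCard (InSnT Tpat n) (countJ 0 n)
hasCard-InSnT n = HasCard-resp-⇔ (InSnT⇔ n) (HasCard-reverse (hasCard-perms n))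

theorem3p44 : (a : ℕ → ℕ) → (∀ n → HasCard (InSnT Tpat n) (a n))
    → (s u r t : PS) → IsSqrt √5ₖ s → IsSqrt (-ₖ √5ₖ) u
    → IsRoot √5ₖ s r → IsRoot (-ₖ √5ₖ) u t
    → NonZeroPS r × NonZeroPS t
    × NonZeroPS (X *ₚ r *ₚ t +ₚ X *ₚ t +ₚ X *ₚ r -ₚ r *ₚ t)
    × ((ofSeq a -ₚ const 1ₖ) *ₚ (X *ₚ r *ₚ t +ₚ X *ₚ t +ₚ X *ₚ r -ₚ r *ₚ t)
    ≋ X *ₚ r *ₚ t *ₚ (const 1ₖ +ₚ r *ₚ t))
theorem3p44 a card s u r t √s √u root-s root-u =
  quadraticRoot≢0 φ₊ root-r , quadraticRoot≢0 φ₋ root-t , kernel-denominator≢0 root-r root-t , λ n →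
    trans (*ₚ-cong {g = X *ₚ r *ₚ t +ₚ X *ₚ t +ₚ X *ₚ r -ₚ r *ₚ t}
                   -- Uniqueness of cardinalities replaces each `a k` by `countJ 0 k`.
                   (λ k → cong (λ m → ofℕₖ m +ₖ (-ₖ const 1ₖ k)) (HasCard-unique (card k) (hasCard-InSnT k)))
                   (λ _ → refl) n)
          (countJ-generating-function root-r root-t n)
  where
    root-r : IsQuadraticRoot φ₊ r
    root-r = IsRoot⇒IsQuadraticRoot₊ {s} √s root-s
    root-t : IsQuadraticRoot φ₋ t
    root-t = IsRoot⇒IsQuadraticRoot₋ {u} √u root-u
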